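{- There exist constants $c>0$, $k_0$, and $\varepsilon>0$ such that for all integers $k\geq k_0$ and all integers $n$ with $c\log k\leq n\leq k/4$, \[ R_k(k+n;2^{ -\varepsilon n})\geq \mathrm{tw}_{\lfloor k/n\rfloor}(2). \]
   Context: For a positive integer $N$, $[N]=\{1,2,\dots,N\}$, and $\binom{S}{k}$ denotes the set of all $k$-element subsets of a set $S$. For integers $k<m$ and a real $0<\delta\leq 1$, $R_k(m;\delta)$ denotes the smallest $N$ such that for every coloring of $\binom{[N]}{k}$ by two colors there is an $m$-element set $M\subseteq[N]$ for which one color class contains at least $\left(\frac{1+\delta}{2}\right)\binom{m}{k}$ of the elements of $\binom{M}{k}$. The tower function is defined by $\mathrm{tw}_1(x)=x$ and $\mathrm{tw}_{j+1}(x)=2^{\mathrm{tw}_j(x)}$. -}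

module Defs where

open import Data.Bool using (Bool)
import Data.Bool.Properties as Bool
open import Data.Empty using (⊥)
open import Data.Fin.Subset using (Subset; inside; outside; ∣_∣)
open import Data.Fin.Subset.Properties using (_⊆?_)
open import Data.Integer as ℤ using (ℤ; -[1+_])
import Data.Integer.Properties as ℤ
open import Data.List using (List; []; _∷_; _++_; length; map; filter)
open import Data.Nat as ℕ using (ℕ; zero; suc)
open import Data.Nat.Combinatorics using (_C_)
import Data.Nat.Coprimality as Coprime
import Data.Nat.Properties as ℕ
open import Data.Product using (∃-syntax; _×_; _,_; proj₁; proj₂)
open import Data.Rational as ℚ
  using (ℚ; 0ℚ; 1ℚ; ½; _<_; _≤_; _+_; _*_; _-_; _/_; 1/_; Positive; ↥_; ↧ₙ_; *≤*; *<*)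
import Data.Rational.Properties as ℚ
open import Data.Sum using (_⊎_; inj₁; inj₂)
open import Data.Vec using ([]; _∷_)
open import Function using (_∘_)
open import Relation.Binary.PropositionalEquality
  using (_≡_; refl; sym; trans; cong; subst; subst₂)
open import Relation.Nullary using (¬_; yes; no)
open import Relation.Nullary.Decidable using (_×-dec_; _⊎-dec_)
open import Relation.Unary using (Decidable)

-- Dedekind reals: Lower q means q < x and Upper q means x < q.
record ℝ : Set₁ where
  field
    Lower Upper     : ℚ → Set
    lower-inhabited : ∃[ q ] Lower q
    upper-inhabited : ∃[ q ] Upper q
    lower-closed    : ∀ {p q} → p < q → Lower q → Lower p
    upper-closed    : ∀ {p q} → p < q → Upper p → Upper q
    lower-open      : ∀ {p} → Lower p → ∃[ q ] p < q × Lower q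
    upper-open      : ∀ {q} → Upper q → ∃[ p ] p < q × Upper p
    disjoint        : ∀ {q} → Lower q → Upper q → ⊥
    located         : ∀ {p q} → p < q → Lower p ⊎ Upper q

open ℝ

infix 4 _≤ʳ_
_≤ʳ_ : ℝ → ℝ → Set
x ≤ʳ y = ∀ q → Lower x q → Lower y q

private
  p<p+1 : ∀ p → p < p + 1ℚ
  p<p+1 p = subst (_< p + 1ℚ) (ℚ.+-identityʳ p) (ℚ.+-monoʳ-< p (*<* (ℤ.+<+ ℕ.z<s)))

  p-1<p : ∀ p → p - 1ℚ < p
  p-1<p p = subst (p - 1ℚ <_) (ℚ.+-identityʳ p) (ℚ.+-monoʳ-< p (*<* ℤ.-<+))

fromℚ : ℚ → ℝ
fromℚ a = record
  { Lower           = _< a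
  ; Upper           = a <_
  ; lower-inhabited = a - 1ℚ , p-1<p a
  ; upper-inhabited = a + 1ℚ , p<p+1 a
  ; lower-closed    = ℚ.<-trans
  ; upper-closed    = λ p<q a<p → ℚ.<-trans a<p p<q
  ; lower-open      = λ p<a → let m , p<m , m<a = ℚ.<-dense p<a in m , p<m , m<a
  ; upper-open      = λ a<q → let m , a<m , m<q = ℚ.<-dense a<q in m , m<q , a<m
  ; disjoint        = ℚ.<-asym
  ; located         = loc
  }
  where
  loc : ∀ {p q} → p < q → p < a ⊎ a < q
  loc {p} p<q with p ℚ.<? a
  ... | yes p<a = inj₁ p<a
  ... | no  p≮a = inj₂ (ℚ.≤-<-trans (ℚ.≮⇒≥ p≮a) p<q)

fromℕ : ℕ → ℝ
fromℕ n = fromℚ (ℤ.+ n / 1)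

-- The supremum of a decidable, downward closed, nonempty, bounded set of rationals.
sup : (P : ℚ → Set) → Decidable P → (∀ {p q} → p < q → P q → P p) →
      ∃[ q ] P q → ∃[ q ] ¬ P q → ℝ
sup P P? down (a , Pa) (b , ¬Pb) = record
  { Lower           = λ q → ∃[ r ] q < r × P r
  ; Upper           = λ q → ∃[ r ] r < q × ¬ P r
  ; lower-inhabited = a - 1ℚ , a , p-1<p a , Pa
  ; upper-inhabited = b + 1ℚ , b , p<p+1 b , ¬Pb
  ; lower-closed    = λ { p<q (r , q<r , Pr) → r , ℚ.<-trans p<q q<r , Pr }
  ; upper-closed    = λ { p<q (r , r<p , ¬Pr) → r , ℚ.<-trans r<p p<q , ¬Pr }
  ; lower-open      = λ { (r , p<r , Pr) →
                        let m , p<m , m<r = ℚ.<-dense p<r in m , p<m , r , m<r , Pr }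
  ; upper-open      = λ { (r , r<q , ¬Pr) →
                        let m , r<m , m<q = ℚ.<-dense r<q in m , m<q , r , r<m , ¬Pr }
  ; disjoint        = λ { (r , q<r , Pr) (s , s<q , ¬Ps) → ¬Ps (down (ℚ.<-trans s<q q<r) Pr) }
  ; located         = loc
  }
  where
  loc : ∀ {p q} → p < q → (∃[ r ] p < r × P r) ⊎ (∃[ r ] r < q × ¬ P r)
  loc p<q with ℚ.<-dense p<q
  ... | m , p<m , m<q with P? m
  ...   | yes Pm = inj₁ (m , p<m , Pm)
  ...   | no ¬Pm = inj₂ (m , m<q , ¬Pm)

-- The image of x under (the extension to ℝ of) the increasing bijection f of ℚ with inverse g.
image : (f g : ℚ → ℚ) →
        (∀ {p q} → p < q → f p < f q) → (∀ {p q} → p < q → g p < g q) →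
        (∀ q → f (g q) ≡ q) → (∀ q → g (f q) ≡ q) → ℝ → ℝ
image f g f-mono g-mono fg gf x = record
  { Lower           = Lower x ∘ g
  ; Upper           = Upper x ∘ g
  ; lower-inhabited = let q , l = lower-inhabited x in f q , subst (Lower x) (sym (gf q)) l
  ; upper-inhabited = let q , u = upper-inhabited x in f q , subst (Upper x) (sym (gf q)) u
  ; lower-closed    = lower-closed x ∘ g-mono
  ; upper-closed    = upper-closed x ∘ g-mono
  ; lower-open      = λ {p} l → let q , p<q , l′ = lower-open x l in
                        f q , subst (_< f q) (fg p) (f-mono p<q) , subst (Lower x) (sym (gf q)) l′
  ; upper-open      = λ {q} u → let p , p<q , u′ = upper-open x u in
                        f p , subst (f p <_) (fg q) (f-mono p<q) , subst (Upper x) (sym (gf p)) u′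
  ; disjoint        = disjoint x
  ; located         = located x ∘ g-mono
  }

infixl 6 _+ʳ_
_+ʳ_ : ℚ → ℝ → ℝ
a +ʳ x = image (a +_) (ℚ.- a +_) (ℚ.+-monoʳ-< a) (ℚ.+-monoʳ-< (ℚ.- a))
  (λ q → trans (sym (ℚ.+-assoc a (ℚ.- a) q))
           (trans (cong (_+ q) (ℚ.+-inverseʳ a)) (ℚ.+-identityˡ q)))
  (λ q → trans (sym (ℚ.+-assoc (ℚ.- a) a q))
           (trans (cong (_+ q) (ℚ.+-inverseˡ a)) (ℚ.+-identityˡ q)))
  x

infixl 7 _*ʳ_
_*ʳ_ : (a : ℚ) .{{_ : Positive a}} → ℝ → ℝ
a *ʳ x = image (a *_) (a⁻¹ *_) (ℚ.*-monoʳ-<-pos a) (ℚ.*-monoʳ-<-pos a⁻¹ {{ℚ.1/pos⇒pos a}})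
  (λ q → trans (sym (ℚ.*-assoc a a⁻¹ q))
           (trans (cong (_* q) (ℚ.*-inverseʳ a {{a≢0}})) (ℚ.*-identityˡ q)))
  (λ q → trans (sym (ℚ.*-assoc a⁻¹ a q))
           (trans (cong (_* q) (ℚ.*-inverseˡ a {{a≢0}})) (ℚ.*-identityˡ q)))
  x
  where
  .a≢0 : ℚ.NonZero a
  a≢0 = ℚ.pos⇒nonZero a
  a⁻¹ : ℚ
  a⁻¹ = 1/_ a {{a≢0}}

infixl 7 _×ʳ_
_×ʳ_ : ℕ → ℝ → ℝ
zero  ×ʳ x = fromℚ 0ℚ
suc n ×ʳ x = _*ʳ_ (ℤ.+ suc n / 1) {{ℚ.normalize-pos (suc n) 1}} x

infixr 8 _^_
_^_ : ℚ → ℕ → ℚ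
q ^ zero  = 1ℚ
q ^ suc n = q * q ^ n

2^ℤ_ : ℤ → ℚ
2^ℤ (ℤ.+ n)  = (ℤ.+ 2 / 1) ^ n
2^ℤ -[1+ n ] = ½ ^ suc n

private
  ^-nonNeg : ∀ q n → 0ℚ ≤ q → 0ℚ ≤ q ^ n
  ^-nonNeg q zero    0≤q = *≤* (ℤ.+≤+ ℕ.z≤n)
  ^-nonNeg q (suc n) 0≤q = subst (_≤ q * q ^ n) (ℚ.*-zeroʳ q)
    (ℚ.*-monoˡ-≤-nonNeg q {{ℚ.nonNegative 0≤q}} (^-nonNeg q n 0≤q))

  ^-mono-≤ : ∀ {p q} n → 0ℚ ≤ p → p ≤ q → p ^ n ≤ q ^ n
  ^-mono-≤ zero _ _ = ℚ.≤-refl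
  ^-mono-≤ {p} {q} (suc n) 0≤p p≤q = ℚ.≤-trans
    (ℚ.*-monoˡ-≤-nonNeg p {{ℚ.nonNegative 0≤p}} (^-mono-≤ n 0≤p p≤q))
    (ℚ.*-monoʳ-≤-nonNeg (q ^ n) {{ℚ.nonNegative (^-nonNeg q n (ℚ.≤-trans 0≤p p≤q))}} p≤q)

  1≤^ : ∀ q n → 1ℚ ≤ q → 1ℚ ≤ q ^ n
  1≤^ q zero    _   = ℚ.≤-refl
  1≤^ q (suc n) 1≤q = ℚ.≤-trans 1≤q (subst (_≤ q * q ^ n) (ℚ.*-identityʳ q)
    (ℚ.*-monoˡ-≤-nonNeg q {{ℚ.nonNegative 0≤q}} (1≤^ q n 1≤q)))
    where
    0≤q : 0ℚ ≤ q
    0≤q = ℚ.≤-trans (*≤* (ℤ.+≤+ ℕ.z≤n)) 1≤q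

  q≤^ : ∀ q n → 1ℚ ≤ q → q ≤ q ^ suc n
  q≤^ q n 1≤q = subst (_≤ q * q ^ n) (ℚ.*-identityʳ q)
    (ℚ.*-monoˡ-≤-nonNeg q {{ℚ.nonNegative (ℚ.≤-trans (*≤* (ℤ.+≤+ ℕ.z≤n)) 1≤q)}} (1≤^ q n 1≤q))

  0≤2^ℤ : ∀ z → 0ℚ ≤ 2^ℤ z
  0≤2^ℤ (ℤ.+ n)  = ^-nonNeg (ℤ.+ 2 / 1) n (*≤* (ℤ.+≤+ ℕ.z≤n))
  0≤2^ℤ -[1+ n ] = ^-nonNeg ½ (suc n) (*≤* (ℤ.+≤+ ℕ.z≤n))

  -1<0 : ℚ.- 1ℚ < 0ℚ
  -1<0 = *<* ℤ.-<+

-- For r = a / b in lowest terms, the set is { q | q < 0 or q ^ b ≤ 2 ^ a }.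
2^_ : ℚ → ℝ
2^ r = sup P (λ q → (q ℚ.<? 0ℚ) ⊎-dec (q ^ ↧ₙ r ℚ.≤? t)) down (ℚ.- 1ℚ , inj₁ -1<0) (t + 1ℚ , bound)
  where
  t : ℚ
  t = 2^ℤ (↥ r)
  P : ℚ → Set
  P q = q < 0ℚ ⊎ q ^ ↧ₙ r ≤ t
  down : ∀ {p q} → p < q → P q → P p
  down {p} p<q (inj₁ q<0) = inj₁ (ℚ.<-trans p<q q<0)
  down {p} p<q (inj₂ h) with p ℚ.<? 0ℚ
  ... | yes p<0 = inj₁ p<0
  ... | no  p≮0 = inj₂ (ℚ.≤-trans (^-mono-≤ (↧ₙ r) (ℚ.≮⇒≥ p≮0) (ℚ.<⇒≤ p<q)) h)
  1≤t+1 : 1ℚ ≤ t + 1ℚ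
  1≤t+1 = subst (_≤ t + 1ℚ) (ℚ.+-identityˡ 1ℚ) (ℚ.+-monoˡ-≤ 1ℚ (0≤2^ℤ (↥ r)))
  bound : ¬ P (t + 1ℚ)
  bound (inj₁ t+1<0) = ℚ.<-irrefl refl
    (ℚ.<-≤-trans (ℚ.≤-<-trans 1≤t+1 t+1<0) (*≤* (ℤ.+≤+ ℕ.z≤n)))
  bound (inj₂ h) = ℚ.<-irrefl refl
    (ℚ.<-≤-trans (p<p+1 t) (ℚ.≤-trans (q≤^ (t + 1ℚ) (ℚ.denominator-1 r) 1≤t+1) h))

private
  n<2^n : ∀ n → n ℕ.< 2 ℕ.^ n
  n<2^n zero    = ℕ.z<s
  n<2^n (suc n) = ℕ.≤-trans (ℕ.+-mono-≤ (ℕ.m^n>0 2 n) (n<2^n n))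
    (ℕ.≤-reflexive (cong (2 ℕ.^ n ℕ.+_) (sym (ℕ.+-identityʳ (2 ℕ.^ n)))))

-- For k ≥ 1, so that log₂ k ≥ 0, the set is { a / b | a / b < 0 or 2 ^ a ≤ k ^ b };
-- the value at k = 0 is the junk value 0.
log₂ : ℕ → ℝ
log₂ k = sup P (λ q → (q ℚ.<? 0ℚ) ⊎-dec (2 ℕ.^ ℤ.∣ ↥ q ∣ ℕ.≤? k ℕ.^ ↧ₙ q)) down
  (ℚ.- 1ℚ , inj₁ -1<0) (ℚ.mkℚ (ℤ.+ k) 0 (Coprime.sym (Coprime.1-coprimeTo k)) , bound)
  where
  P : ℚ → Set
  P q = q < 0ℚ ⊎ 2 ℕ.^ ℤ.∣ ↥ q ∣ ℕ.≤ k ℕ.^ ↧ₙ q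
  bound : ¬ P (ℚ.mkℚ (ℤ.+ k) 0 (Coprime.sym (Coprime.1-coprimeTo k)))
  bound (inj₁ (*<* k<0)) = ℤ.≤⇒≯ (ℤ.+≤+ ℕ.z≤n) (subst (ℤ._< ℤ.+ 0) (ℤ.*-identityʳ (ℤ.+ k)) k<0)
  bound (inj₂ h) = ℕ.<⇒≱ (n<2^n k) (subst (2 ℕ.^ k ℕ.≤_) (ℕ.*-identityʳ k) h)
  root-mono : ∀ a b c d .{{_ : ℕ.NonZero d}} → a ℕ.* d ℕ.≤ c ℕ.* b →
              2 ℕ.^ c ℕ.≤ k ℕ.^ d → 2 ℕ.^ a ℕ.≤ k ℕ.^ b
  root-mono a b c d ad≤cb h = ℕ.≮⇒≥ λ k^b<2^a → ℕ.<⇒≱ (ℕ.^-monoˡ-< d k^b<2^a) (begin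
    (2 ℕ.^ a) ℕ.^ d  ≡⟨ ℕ.^-*-assoc 2 a d ⟩
    2 ℕ.^ (a ℕ.* d)  ≤⟨ ℕ.^-monoʳ-≤ 2 ad≤cb ⟩
    2 ℕ.^ (c ℕ.* b)  ≡⟨ ℕ.^-*-assoc 2 c b ⟨
    (2 ℕ.^ c) ℕ.^ b  ≤⟨ ℕ.^-monoˡ-≤ b h ⟩
    (k ℕ.^ d) ℕ.^ b  ≡⟨ ℕ.^-*-assoc k d b ⟩
    k ℕ.^ (d ℕ.* b)  ≡⟨ cong (k ℕ.^_) (ℕ.*-comm d b) ⟩
    k ℕ.^ (b ℕ.* d)  ≡⟨ ℕ.^-*-assoc k b d ⟨
    (k ℕ.^ b) ℕ.^ d  ∎)
    where open ℕ.≤-Reasoning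
  down : ∀ {p q} → p < q → P q → P p
  down p<q (inj₁ q<0) = inj₁ (ℚ.<-trans p<q q<0)
  down {ℚ.mkℚ -[1+ _ ] _ _} {_} p<q (inj₂ h) = inj₁ (*<* ℤ.-<+)
  down {ℚ.mkℚ (ℤ.+ a) b-1 _} {ℚ.mkℚ (ℤ.+ c) d-1 _} (*<* ad<cb) (inj₂ h) = inj₂
    (root-mono a (suc b-1) c (suc d-1) (ℤ.drop‿+≤+ (subst₂ ℤ._≤_
      (sym (ℤ.pos-* a (suc d-1))) (sym (ℤ.pos-* c (suc b-1))) (ℤ.<⇒≤ ad<cb))) h)
  down {_} {ℚ.mkℚ -[1+ _ ] _ _} p<q (inj₂ h) = inj₁ (ℚ.<-trans p<q (*<* ℤ.-<+))

tw : ℕ → ℕ → ℕ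
tw zero          x = x -- junk: tw j is meant for j ≥ 1
tw (suc zero)    x = x
tw (suc (suc j)) x = 2 ℕ.^ tw (suc j) x

-- [N] is Fin N, and KSubset N k is the set of its k-element subsets.
KSubset : ℕ → ℕ → Set
KSubset N k = ∃[ S ] ∣_∣ {N} S ≡ k

-- Every k-element subset, each exactly once.
kSubsets : ∀ N k → List (KSubset N k)
kSubsets zero    zero    = ([] , refl) ∷ []
kSubsets zero    (suc k) = []
kSubsets (suc N) zero    = map (λ (S , e) → outside ∷ S , e) (kSubsets N zero)
kSubsets (suc N) (suc k) = map (λ (S , e) → inside ∷ S , cong suc e) (kSubsets N k)
                        ++ map (λ (S , e) → outside ∷ S , e) (kSubsets N (suc k))

Colouring : ℕ → ℕ → Set
Colouring N k = KSubset N k → Bool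

colourCount : ∀ {N k} → Colouring N k → Subset N → Bool → ℕ
colourCount {N} {k} χ M b =
  length (filter (λ S → (proj₁ S ⊆? M) ×-dec (χ S Bool.≟ b)) (kSubsets N k))

Arrows : ℕ → ℕ → ℝ → ℕ → Set
Arrows k m δ N = (χ : Colouring N k) → ∃[ M ] ∃[ b ]
  ∣ M ∣ ≡ m × (m C k) ×ʳ (½ *ʳ (1ℚ +ʳ δ)) ≤ʳ fromℕ (colourCount χ M b)

-- R_k(m; δ) = N. Such an N exists for 0 < δ ≤ 1 and k < m by Ramsey's theorem, and is unique.
record IsRamseyNumber (k m : ℕ) (δ : ℝ) (N : ℕ) : Set where
  field
    arrows  : Arrows k m δ N
    minimal : ∀ N′ → Arrows k m δ N′ → N ℕ.≤ N′

{-# OPTIONS --safe #-}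
module Submission where

open import Defs hiding (_^_)
import Defs
open import Data.Bool using (Bool; true; false; not; _xor_; T; if_then_else_)
import Data.Bool.Properties as Bool
open import Data.Fin as Fin using (Fin; toℕ)
import Data.Fin.Properties as Fin
open import Data.Fin.Subset using (Subset; inside; outside; ∣_∣; _⊆_)
open import Data.Fin.Subset.Properties using (_⊆?_; drop-∷-⊆; out⊆; in⊆in)
open import Data.Integer as ℤ using (ℤ; +_; -[1+_]; 0ℤ; 1ℤ; -1ℤ)
import Data.Integer.Properties as ℤ
import Data.Integer.Tactic.RingSolver as ℤSolver
open import Data.List using (List; []; _∷_; _++_; length; map; filter; take; drop)
open import Data.List.Properties using (take-all; length-++; filter-++)
open import Data.Nat as ℕ using (ℕ; zero; suc; NonZero; _+_; _*_; _∸_; _^_; _!; _≤_; _<_; _/_; _%_; _<ᵇ_; z≤n; s≤s)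
open import Data.Nat.Combinatorics using (_C_; nCk≡nC[n∸k]; nCk+nC[k+1]≡[n+1]C[k+1]; k![n∸k]!∣n!)
open import Data.Nat.Combinatorics.Specification using (nCk≡n!/k![n-k]!)
import Data.Nat.Coprimality as Coprime
import Data.Nat.DivMod as ℕ
import Data.Nat.Properties as ℕ
import Data.Nat.Tactic.RingSolver as ℕSolver
open import Data.Product using (∃-syntax; Σ-syntax; _×_; _,_; proj₁)
open import Data.Rational as ℚ using (ℚ; Positive; mkℚ; 0ℚ; 1ℚ; ½; 1/_; *≤*; *<*)
import Data.Rational.Properties as ℚ
import Data.Rational.Solver as ℚSolver
open import Data.Sum using (_⊎_; inj₁; inj₂)
import Data.Vec as Vec
open import Function using (_∘_)
open import Relation.Binary.PropositionalEquality
open import Relation.Nullary using (¬_; yes; no; contradiction; does)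
open import Relation.Nullary.Decidable using (_×-dec_)
open import Relation.Unary using (Decidable)
import Algebra.Properties.CommutativeSemiring.Binomial ℕ.+-*-commutativeSemiring as Binomial
open import Algebra.Properties.Semiring.Exp ℕ.+-*-semiring using () renaming (_^_ to _^ˢ_)
open import Algebra.Properties.Semiring.Mult ℕ.+-*-semiring using () renaming (_×_ to _×ˢ_)
open import Algebra.Properties.Semiring.Sum ℕ.+-*-semiring using (sum)

-- A k-subset K of a (k + n)-set M is a word of k ones and n zeros.  Cut K into blocks of Θ(k / n)
-- consecutive elements and colour it by the parity of one bit per block, read off a window of
-- k / n + 1 elements in the middle of the block.  Iterated Cole–Vishkin recolouring gives each k / n
-- elements of [N] one of eight colours, distinct for windows that differ by a shift; the bit says
-- whether the colour increases under the shift, so it is not constant on eight consecutive windows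
-- of M.  If a block contains exactly seven zeros, all outside its window, then moving them from one
-- side of the window to the other shifts the window through eight consecutive positions of M and
-- leaves the rest of K alone.  Weighting zeros by z = n / (k + n) and ones by 1 - z, this happens
-- with probability bounded below, so the cancellation saves a constant factor in each of the Θ(n)
-- blocks.  Hence the signed count is at most 2^(- Ω(n)) z^(- n) (1 - z)^(- k), while the binomial
-- coefficient is at least z^(- n) (1 - z)^(- k) / (k + n + 1), as n is the mode of the binomial
-- distribution.  The hypothesis c log k ≤ n pays for the factor k + n + 1.

-- Weighted sums over words

segment : (ℕ → ℕ) → ℕ → ℕ → List ℕ
segment y zero    j = []
segment y (suc h) j = y j ∷ segment y h (suc j)

scale-≤ : ∀ a {x y} → x ℤ.≤ y → + a ℤ.* x ℤ.≤ + a ℤ.* y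
scale-≤ a = ℤ.*-monoˡ-≤-nonNeg (+ a)

scale-0≤ : ∀ a {x} → 0ℤ ℤ.≤ x → 0ℤ ℤ.≤ + a ℤ.* x
scale-0≤ a {x} 0≤x = subst (ℤ._≤ + a ℤ.* x) (ℤ.*-zeroʳ (+ a)) (scale-≤ a 0≤x)

-- The number of words with m ones and g zeros that do not end in a zero.
ways : ℕ → ℕ → ℕ
ways m       zero    = 1
ways zero    (suc g) = 0
ways (suc m) (suc g) = ways m (suc g) + ways (suc m) g

ways-mono : ∀ l m g → ways m g ≤ ways (l + m) g
ways-mono zero    m g       = ℕ.≤-refl
ways-mono (suc l) m zero    = ℕ.≤-refl
ways-mono (suc l) m (suc g) = ℕ.≤-trans (ways-mono l m (suc g)) (ℕ.m≤m+n _ _)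

-- For each `i < q`, let the word begin with `i` ones and a zero. At least `m` ones and exactly `g`
-- zeros remain, so there are at least `ways m g` continuations.
ways-step : ∀ q m g → q * ways m g ≤ ways (q + m) (suc g)
ways-step zero    m g = z≤n
ways-step (suc q) m g = begin
  ways m g + q * ways m g                    ≤⟨ ℕ.+-mono-≤ (ways-mono (suc q) m g) (ways-step q m g) ⟩
  ways (suc q + m) g + ways (q + m) (suc g)  ≡⟨ ℕ.+-comm (ways (suc q + m) g) _ ⟩
  ways (suc q + m) (suc g)                   ∎
  where open ℕ.≤-Reasoning

-- Cut the ones into `g` groups of `q`. One zero per group can be placed, independently, in front of
-- any of the `q` ones of its group.
^≤ways : ∀ q g → q ^ g ≤ ways (g * q) g
^≤ways q zero    = ℕ.≤-refl
^≤ways q (suc g) = ℕ.≤-trans (ℕ.*-monoʳ-≤ q (^≤ways q g)) (ways-step q (g * q) g)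

^≤ways-spread : ∀ q g h → q ^ (g + h) ≤ ways ((g + h) * q) g * ways ((g + h) * q) h
^≤ways-spread q g h = begin
  q ^ (g + h)                                    ≡⟨ ℕ.^-distribˡ-+-* q g h ⟩
  q ^ g * q ^ h                                  ≤⟨ ℕ.*-mono-≤ (^≤ways q g) (^≤ways q h) ⟩
  ways (g * q) g * ways (h * q) h                ≤⟨ ℕ.*-mono-≤ (ways-mono (h * q) (g * q) g) (ways-mono (g * q) (h * q) h) ⟩
  ways (h * q + g * q) g * ways (g * q + h * q) h ≡⟨ cong₂ (λ l m → ways l g * ways m h)
      (trans (ℕ.+-comm (h * q) (g * q)) (sym (ℕ.*-distribʳ-+ q g h))) (sym (ℕ.*-distribʳ-+ q g h)) ⟩
  ways ((g + h) * q) g * ways ((g + h) * q) h    ∎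
  where open ℕ.≤-Reasoning

module Words (y : ℕ → ℕ) (a b : ℕ) where

  Weight : Set
  Weight = List ℕ → ℕ → ℕ → ℤ

  -- A word is read from position `j` and stops right after its `m`-th one; `n` is a supply of zeros
  -- that need not be exhausted. A one carries the factor `b`, a zero the factor `a`. The weight is
  -- evaluated at the stopping state: the entries of `y` at the ones, the position reached and the
  -- zeros left.
  wordSum : ℕ → ℕ → ℕ → Weight → ℤ
  wordSum zero    n       j w = w [] j n
  wordSum (suc m) zero    j w = + b ℤ.* wordSum m zero (suc j) (w ∘ (y j ∷_))
  wordSum (suc m) (suc n) j w = + b ℤ.* wordSum m (suc n) (suc j) (w ∘ (y j ∷_))
                            ℤ.+ + a ℤ.* wordSum (suc m) n (suc j) w

  wordSum-cong : ∀ m n j {w v} → (∀ K j i → length K ≡ m → w K j i ≡ v K j i) →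
                 wordSum m n j w ≡ wordSum m n j v
  wordSum-cong zero    n       j eq = eq [] j n refl
  wordSum-cong (suc m) zero    j eq =
    cong (+ b ℤ.*_) (wordSum-cong m zero (suc j) λ K j i e → eq _ j i (cong suc e))
  wordSum-cong (suc m) (suc n) j eq = cong₂ ℤ._+_
    (cong (+ b ℤ.*_) (wordSum-cong m (suc n) (suc j) λ K j i e → eq _ j i (cong suc e)))
    (cong (+ a ℤ.*_) (wordSum-cong (suc m) n (suc j) eq))

  wordSum-mono : ∀ m n j {w v} → (∀ K j i → w K j i ℤ.≤ v K j i) →
                 wordSum m n j w ℤ.≤ wordSum m n j v
  wordSum-mono zero    n       j le = le [] j n
  wordSum-mono (suc m) zero    j le = scale-≤ b (wordSum-mono m zero (suc j) λ K → le (y j ∷ K))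
  wordSum-mono (suc m) (suc n) j le = ℤ.+-mono-≤
    (scale-≤ b (wordSum-mono m (suc n) (suc j) λ K → le (y j ∷ K)))
    (scale-≤ a (wordSum-mono (suc m) n (suc j) le))

  wordSum-nonNeg : ∀ m n j {w} → (∀ K j i → 0ℤ ℤ.≤ w K j i) → 0ℤ ℤ.≤ wordSum m n j w
  wordSum-nonNeg zero    n       j le = le [] j n
  wordSum-nonNeg (suc m) zero    j le = scale-0≤ b (wordSum-nonNeg m zero (suc j) λ K → le (y j ∷ K))
  wordSum-nonNeg (suc m) (suc n) j le = ℤ.+-mono-≤
    (scale-0≤ b (wordSum-nonNeg m (suc n) (suc j) λ K → le (y j ∷ K)))
    (scale-0≤ a (wordSum-nonNeg (suc m) n (suc j) le))

  wordSum-⊕ : ∀ m n j w v → wordSum m n j (λ K j i → w K j i ℤ.+ v K j i)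
              ≡ wordSum m n j w ℤ.+ wordSum m n j v
  wordSum-⊕ zero    n       j w v = refl
  wordSum-⊕ (suc m) zero    j w v
    rewrite wordSum-⊕ m zero (suc j) (w ∘ (y j ∷_)) (v ∘ (y j ∷_)) = ℤ.*-distribˡ-+ (+ b) _ _
  wordSum-⊕ (suc m) (suc n) j w v
    rewrite wordSum-⊕ m (suc n) (suc j) (w ∘ (y j ∷_)) (v ∘ (y j ∷_))
          | wordSum-⊕ (suc m) n (suc j) w v =
    lemma (+ a) (+ b) (wordSum m (suc n) (suc j) (w ∘ (y j ∷_))) (wordSum (suc m) n (suc j) w)
                      (wordSum m (suc n) (suc j) (v ∘ (y j ∷_))) (wordSum (suc m) n (suc j) v)
    where
    lemma : ∀ a b w w′ v v′ → b ℤ.* (w ℤ.+ v) ℤ.+ a ℤ.* (w′ ℤ.+ v′) ≡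
            (b ℤ.* w ℤ.+ a ℤ.* w′) ℤ.+ (b ℤ.* v ℤ.+ a ℤ.* v′)
    lemma = ℤSolver.solve-∀

  wordSum-*ˡ : ∀ m n j c w → wordSum m n j (λ K j i → c ℤ.* w K j i) ≡ c ℤ.* wordSum m n j w
  wordSum-*ˡ zero    n       j c w = refl
  wordSum-*ˡ (suc m) zero    j c w rewrite wordSum-*ˡ m zero (suc j) c (w ∘ (y j ∷_)) =
    lemma (+ b) c (wordSum m zero (suc j) (w ∘ (y j ∷_)))
    where
    lemma : ∀ b c w → b ℤ.* (c ℤ.* w) ≡ c ℤ.* (b ℤ.* w)
    lemma = ℤSolver.solve-∀
  wordSum-*ˡ (suc m) (suc n) j c w
    rewrite wordSum-*ˡ m (suc n) (suc j) c (w ∘ (y j ∷_)) | wordSum-*ˡ (suc m) n (suc j) c w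
    = lemma (+ a) (+ b) c (wordSum m (suc n) (suc j) (w ∘ (y j ∷_))) (wordSum (suc m) n (suc j) w)
    where
    lemma : ∀ a b c w w′ → b ℤ.* (c ℤ.* w) ℤ.+ a ℤ.* (c ℤ.* w′) ≡ c ℤ.* (b ℤ.* w ℤ.+ a ℤ.* w′)
    lemma = ℤSolver.solve-∀

  -- The possible continuations after the `m`-th one depend only on the position and the zeros left.
  -- By this Markov property blocks are split off one at a time.
  wordSum-+ : ∀ m m′ n j w → wordSum (m + m′) n j w ≡
              wordSum m n j (λ K j i → wordSum m′ i j (λ K′ → w (K ++ K′)))
  wordSum-+ zero    m′ n       j w = refl
  wordSum-+ (suc m) m′ zero    j w = cong (+ b ℤ.*_) (wordSum-+ m m′ zero (suc j) _)
  wordSum-+ (suc m) m′ (suc n) j w = cong₂ ℤ._+_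
    (cong (+ b ℤ.*_) (wordSum-+ m m′ (suc n) (suc j) _))
    (cong (+ a ℤ.*_) (wordSum-+ (suc m) m′ n (suc j) w))

  -- The supply of zeros never grows while a word is read, so every stopping state has fewer than
  -- `s` zeros left.
  wordSum-vanish : ∀ s m n j w → (∀ K j i → i < s → w K j i ≡ 0ℤ) → n < s → wordSum m n j w ≡ 0ℤ
  wordSum-vanish s zero    n       j w w≡0 n<s = w≡0 [] j n n<s
  wordSum-vanish s (suc m) zero    j w w≡0 n<s
    rewrite wordSum-vanish s m zero (suc j) (w ∘ (y j ∷_)) (λ K → w≡0 _) n<s = ℤ.*-zeroʳ (+ b)
  wordSum-vanish s (suc m) (suc n) j w w≡0 n<s
    rewrite wordSum-vanish s m (suc n) (suc j) (w ∘ (y j ∷_)) (λ K → w≡0 _) n<s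
          | wordSum-vanish s (suc m) n (suc j) w w≡0 (ℕ.<-trans (ℕ.n<1+n n) n<s)
          | ℤ.*-zeroʳ (+ b) | ℤ.*-zeroʳ (+ a) = refl

  -- The letters behave as independent ones and zeros of probabilities b / (a + b) and a / (a + b).
  wordSum-^ : ∀ m n j → wordSum m n j (λ _ _ i → + ((a + b) ^ i)) ℤ.≤ + ((a + b) ^ (m + n))
  wordSum-^ zero    n       j = ℤ.≤-refl
  wordSum-^ (suc m) zero    j = begin
    + b ℤ.* wordSum m zero (suc j) _  ≤⟨ scale-≤ b (wordSum-^ m zero (suc j)) ⟩
    + b ℤ.* + ((a + b) ^ (m + 0))     ≡⟨ ℤ.pos-* b _ ⟨
    + (b * (a + b) ^ (m + 0))         ≤⟨ ℤ.+≤+ (ℕ.*-monoˡ-≤ _ (ℕ.m≤n+m b a)) ⟩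
    + ((a + b) * (a + b) ^ (m + 0))   ∎
    where open ℤ.≤-Reasoning
  wordSum-^ (suc m) (suc n) j = begin
    + b ℤ.* wordSum m (suc n) (suc j) _ ℤ.+ + a ℤ.* wordSum (suc m) n (suc j) _
      ≤⟨ ℤ.+-mono-≤ (scale-≤ b (wordSum-^ m (suc n) (suc j)))
                    (scale-≤ a (wordSum-^ (suc m) n (suc j))) ⟩
    + b ℤ.* + ((a + b) ^ (m + suc n)) ℤ.+ + a ℤ.* + ((a + b) ^ (suc m + n))
      ≡⟨ cong (λ e → + b ℤ.* + ((a + b) ^ e) ℤ.+ + a ℤ.* + ((a + b) ^ (suc m + n))) (ℕ.+-suc m n) ⟩
    + b ℤ.* + ((a + b) ^ (suc m + n)) ℤ.+ + a ℤ.* + ((a + b) ^ (suc m + n))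
      ≡⟨ ℤ.*-distribʳ-+ (+ ((a + b) ^ (suc m + n))) (+ b) (+ a) ⟨
    + (b + a) ℤ.* + ((a + b) ^ (suc m + n))
      ≡⟨ ℤ.pos-* (b + a) _ ⟨
    + ((b + a) * (a + b) ^ (suc m + n))
      ≡⟨ cong +_ (cong₂ (λ d e → d * (a + b) ^ e) (ℕ.+-comm b a) (sym (ℕ.+-suc m n))) ⟩
    + ((a + b) * (a + b) ^ (m + suc n)) ∎
    where open ℤ.≤-Reasoning

  -- Only the word without zeros is kept; all others contribute non-negative amounts. This is how a
  -- window is forced to be free of zeros.
  wordSum-head : ∀ m n j w → (∀ K j i → 0ℤ ℤ.≤ w K j i) →
                 + (b ^ m) ℤ.* w (segment y m j) (j + m) n ℤ.≤ wordSum m n j w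
  wordSum-head zero    n       j w 0≤w rewrite ℕ.+-identityʳ j = ℤ.≤-reflexive (ℤ.*-identityˡ _)
  wordSum-head (suc m) n       j w 0≤w = begin
    + (b * b ^ m) ℤ.* u (j + suc m)      ≡⟨ cong₂ (λ p q → p ℤ.* u q) (ℤ.pos-* b (b ^ m)) (ℕ.+-suc j m) ⟩
    + b ℤ.* + (b ^ m) ℤ.* u (suc j + m)  ≡⟨ ℤ.*-assoc (+ b) (+ (b ^ m)) _ ⟩
    + b ℤ.* (+ (b ^ m) ℤ.* u (suc j + m)) ≤⟨ scale-≤ b (wordSum-head m n (suc j) (w ∘ (y j ∷_)) (λ K → 0≤w _)) ⟩
    + b ℤ.* wordSum m n (suc j) _         ≤⟨ step n ⟩
    wordSum (suc m) n j w ∎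
    where
    open ℤ.≤-Reasoning
    u : ℕ → ℤ
    u i = w (segment y (suc m) j) i n
    step : ∀ n → + b ℤ.* wordSum m n (suc j) (w ∘ (y j ∷_)) ℤ.≤ wordSum (suc m) n j w
    step zero    = ℤ.≤-refl
    step (suc n) = ℤ.i≤i+j _ _ {{ℤ.nonNegative (scale-0≤ a (wordSum-nonNeg (suc m) n (suc j) 0≤w))}}

  -- The total weight of the words with m ones and g zeros that do not end in a zero.
  mass : ℕ → ℕ → ℕ
  mass m g = b ^ m * (a ^ g * ways m g)

  mass-suc : ∀ m g → + mass (suc m) (suc g) ≡ + b ℤ.* + mass m (suc g) ℤ.+ + a ℤ.* + mass (suc m) g
  mass-suc m g = begin
    + mass (suc m) (suc g)                            ≡⟨ cong +_ (lemma a b (b ^ m) (a ^ g) (ways m (suc g)) (ways (suc m) g)) ⟩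
    + (b * mass m (suc g) + a * mass (suc m) g)       ≡⟨ cong₂ ℤ._+_ (ℤ.pos-* b _) (ℤ.pos-* a _) ⟩
    + b ℤ.* + mass m (suc g) ℤ.+ + a ℤ.* + mass (suc m) g ∎
    where
    open ≡-Reasoning
    lemma : ∀ a b B A u v → b * B * (a * A * (u + v)) ≡ b * (B * (a * A * u)) + a * (b * B * (A * v))
    lemma = ℕSolver.solve-∀

  mass-zero : ∀ m → mass m 0 ≡ b ^ m
  mass-zero m = ℕ.*-identityʳ (b ^ m)

  module _ (w : ℕ → ℕ → ℤ) (0≤w : ∀ j i → 0ℤ ℤ.≤ w j i) where

    private
      W : Weight
      W _ = w

      0≤W : ∀ K j i → 0ℤ ℤ.≤ W K j i
      0≤W _ = 0≤w

    wordSum-term₀ : ∀ m n j → + mass m 0 ℤ.* w (j + (m + 0)) n ℤ.≤ wordSum m n j W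
    wordSum-term₀ m n j rewrite mass-zero m | ℕ.+-identityʳ m = wordSum-head m n j W 0≤W

    -- The words with exactly `g` zeros all stop at the same position with `n` zeros left, so
    -- together they contribute their mass times one value of `w`.
    wordSum-term : ∀ m g n j → + mass m g ℤ.* w (j + (m + g)) n ℤ.≤ wordSum m (g + n) j W
    wordSum-term m       zero    n j = wordSum-term₀ m n j
    wordSum-term zero    (suc g) n j rewrite ℕ.*-zeroʳ (a * a ^ g) = wordSum-nonNeg 0 (suc g + n) j {W} 0≤W
    wordSum-term (suc m) (suc g) n j = begin
      + mass (suc m) (suc g) ℤ.* u (j + (suc m + suc g))
        ≡⟨ cong₂ ℤ._*_ (mass-suc m g) (cong u (ℕ.+-suc j (m + suc g))) ⟩
      (+ b ℤ.* + mass m (suc g) ℤ.+ + a ℤ.* + mass (suc m) g) ℤ.* x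
        ≡⟨ lemma (+ b) (+ mass m (suc g)) (+ a) (+ mass (suc m) g) x ⟩
      + b ℤ.* (+ mass m (suc g) ℤ.* x) ℤ.+ + a ℤ.* (+ mass (suc m) g ℤ.* x)
        ≡⟨ cong (λ e → + b ℤ.* (+ mass m (suc g) ℤ.* x) ℤ.+ + a ℤ.* (+ mass (suc m) g ℤ.* u (suc j + e))) (ℕ.+-suc m g) ⟩
      + b ℤ.* (+ mass m (suc g) ℤ.* x) ℤ.+ + a ℤ.* (+ mass (suc m) g ℤ.* u (suc j + (suc m + g)))
        ≤⟨ ℤ.+-mono-≤ (scale-≤ b (wordSum-term m (suc g) n (suc j)))
                      (scale-≤ a (wordSum-term (suc m) g n (suc j))) ⟩
      wordSum (suc m) (suc g + n) j W ∎
      where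
      open ℤ.≤-Reasoning
      u : ℕ → ℤ
      u i = w i n
      x : ℤ
      x = u (suc j + (m + suc g))
      lemma : ∀ b p a q x → (b ℤ.* p ℤ.+ a ℤ.* q) ℤ.* x ≡ b ℤ.* (p ℤ.* x) ℤ.+ a ℤ.* (q ℤ.* x)
      lemma = ℤSolver.solve-∀

    -- Words with `g` zeros and words with `g + 1` zeros are distinct, so both contributions can be
    -- kept at once. They become the two numbers of zeros in front of a window.
    wordSum-term₂ : ∀ m g n j →
      + mass m g ℤ.* w (j + (m + g)) (suc n) ℤ.+ + mass m (suc g) ℤ.* w (j + (m + suc g)) n
      ℤ.≤ wordSum m (g + suc n) j W
    wordSum-term₂ zero    zero    n j rewrite ℕ.*-zeroʳ (a * 1) | ℕ.+-identityʳ j =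
      ℤ.≤-reflexive (trans (ℤ.+-identityʳ _) (ℤ.*-identityˡ _))
    wordSum-term₂ zero    (suc g) n j rewrite ℕ.*-zeroʳ (a * a ^ g) | ℕ.*-zeroʳ (a * (a * a ^ g)) =
      wordSum-nonNeg 0 (suc g + suc n) j {W} 0≤W
    wordSum-term₂ (suc m) zero    n j = begin
      + mass (suc m) 0 ℤ.* w (j + (suc m + 0)) (suc n) ℤ.+ + mass (suc m) 1 ℤ.* w (j + (suc m + 1)) n
        ≡⟨ cong₂ ℤ._+_ (cong₂ ℤ._*_ mass-b (cong (λ e → w e (suc n)) (ℕ.+-suc j (m + 0))))
                       (cong₂ ℤ._*_ (mass-suc m 0) (cong (λ e → w e n) (ℕ.+-suc j (m + 1)))) ⟩
      (+ b ℤ.* + mass m 0) ℤ.* x ℤ.+ (+ b ℤ.* + mass m 1 ℤ.+ + a ℤ.* + mass (suc m) 0) ℤ.* z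
        ≡⟨ lemma (+ b) (+ mass m 0) x (+ mass m 1) (+ a) (+ mass (suc m) 0) z ⟩
      + b ℤ.* (+ mass m 0 ℤ.* x ℤ.+ + mass m 1 ℤ.* z) ℤ.+ + a ℤ.* (+ mass (suc m) 0 ℤ.* z)
        ≡⟨ cong (λ e → + b ℤ.* (+ mass m 0 ℤ.* x ℤ.+ + mass m 1 ℤ.* z) ℤ.+ + a ℤ.* (+ mass (suc m) 0 ℤ.* w (suc j + e) n)) (ℕ.+-suc m 0) ⟩
      + b ℤ.* (+ mass m 0 ℤ.* x ℤ.+ + mass m 1 ℤ.* z) ℤ.+ + a ℤ.* (+ mass (suc m) 0 ℤ.* w (suc j + (suc m + 0)) n)
        ≤⟨ ℤ.+-mono-≤ (scale-≤ b (wordSum-term₂ m 0 n (suc j))) (scale-≤ a (wordSum-term₀ (suc m) n (suc j))) ⟩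
      wordSum (suc m) (suc n) j W ∎
      where
      open ℤ.≤-Reasoning
      x z : ℤ
      x = w (suc j + (m + 0)) (suc n)
      z = w (suc j + (m + 1)) n
      mass-b : + mass (suc m) 0 ≡ + b ℤ.* + mass m 0
      mass-b = trans (cong +_ (ℕ.*-assoc b (b ^ m) 1)) (ℤ.pos-* b (mass m 0))
      lemma : ∀ b p x q a r z → (b ℤ.* p) ℤ.* x ℤ.+ (b ℤ.* q ℤ.+ a ℤ.* r) ℤ.* z ≡
              b ℤ.* (p ℤ.* x ℤ.+ q ℤ.* z) ℤ.+ a ℤ.* (r ℤ.* z)
      lemma = ℤSolver.solve-∀
    wordSum-term₂ (suc m) (suc g) n j = begin
      + mass (suc m) (suc g) ℤ.* w (j + (suc m + suc g)) (suc n)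
        ℤ.+ + mass (suc m) (suc (suc g)) ℤ.* w (j + (suc m + suc (suc g))) n
        ≡⟨ cong₂ ℤ._+_ (cong₂ ℤ._*_ (mass-suc m g) (cong (λ e → w e (suc n)) (ℕ.+-suc j (m + suc g))))
                       (cong₂ ℤ._*_ (mass-suc m (suc g)) (cong (λ e → w e n) (ℕ.+-suc j (m + suc (suc g))))) ⟩
      (+ b ℤ.* p₁ ℤ.+ + a ℤ.* q₁) ℤ.* x ℤ.+ (+ b ℤ.* p₂ ℤ.+ + a ℤ.* q₂) ℤ.* z
        ≡⟨ lemma (+ b) p₁ (+ a) q₁ x p₂ q₂ z ⟩
      + b ℤ.* (p₁ ℤ.* x ℤ.+ p₂ ℤ.* z) ℤ.+ + a ℤ.* (q₁ ℤ.* x ℤ.+ q₂ ℤ.* z)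
        ≡⟨ cong₂ (λ e f → + b ℤ.* (p₁ ℤ.* x ℤ.+ p₂ ℤ.* z) ℤ.+
                          + a ℤ.* (q₁ ℤ.* w (suc j + e) (suc n) ℤ.+ q₂ ℤ.* w (suc j + f) n))
                 (ℕ.+-suc m g) (ℕ.+-suc m (suc g)) ⟩
      + b ℤ.* (p₁ ℤ.* x ℤ.+ p₂ ℤ.* z) ℤ.+
      + a ℤ.* (q₁ ℤ.* w (suc j + (suc m + g)) (suc n) ℤ.+ q₂ ℤ.* w (suc j + (suc m + suc g)) n)
        ≤⟨ ℤ.+-mono-≤ (scale-≤ b (wordSum-term₂ m (suc g) n (suc j)))
                      (scale-≤ a (wordSum-term₂ (suc m) g n (suc j))) ⟩
      wordSum (suc m) (suc g + suc n) j W ∎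
      where
      open ℤ.≤-Reasoning
      p₁ p₂ q₁ q₂ x z : ℤ
      p₁ = + mass m (suc g)
      p₂ = + mass m (suc (suc g))
      q₁ = + mass (suc m) g
      q₂ = + mass (suc m) (suc g)
      x = w (suc j + (m + suc g)) (suc n)
      z = w (suc j + (m + suc (suc g))) n
      lemma : ∀ b p a q x p′ q′ z → (b ℤ.* p ℤ.+ a ℤ.* q) ℤ.* x ℤ.+ (b ℤ.* p′ ℤ.+ a ℤ.* q′) ℤ.* z ≡
              b ℤ.* (p ℤ.* x ℤ.+ p′ ℤ.* z) ℤ.+ a ℤ.* (q ℤ.* x ℤ.+ q′ ℤ.* z)
      lemma = ℤSolver.solve-∀

-- Cancellation within a block

take-length-++ : ∀ {A : Set} {m} (K K′ : List A) → length K ≡ m → take m (K ++ K′) ≡ K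
take-length-++ []      K′ refl = refl
take-length-++ (x ∷ K) K′ refl = cong (x ∷_) (take-length-++ K K′ refl)

drop-length-++ : ∀ {A : Set} {m} (K K′ : List A) → length K ≡ m → drop m (K ++ K′) ≡ K′
drop-length-++ []      K′ refl = refl
drop-length-++ (x ∷ K) K′ refl = drop-length-++ K K′ refl

sgn : Bool → ℤ
sgn false = 1ℤ
sgn true  = -1ℤ

sgn-not : ∀ β → sgn β ℤ.+ sgn (not β) ≡ 0ℤ
sgn-not false = refl
sgn-not true  = refl

sgn-≤ : ∀ β n → sgn β ℤ.* + n ℤ.≤ + n
sgn-≤ false n = ℤ.≤-reflexive (ℤ.*-identityˡ (+ n))
sgn-≤ true  n = ℤ.≤-trans (ℤ.≤-reflexive (ℤ.-1*i≡-i (+ n))) (ℤ.neg-≤-pos {n} {n})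

-- A block of a set K consists of H consecutive elements with r further elements on either side.
module Colour (f : List ℕ → Bool) (r H : ℕ) where

  blockLength : ℕ
  blockLength = r + (H + r)

  total : ℕ → ℕ → ℕ
  total zero    k = k
  total (suc B) k = blockLength + total B k

  window : List ℕ → List ℕ
  window K = take H (drop r (take blockLength K))

  parity : ℕ → List ℕ → Bool
  parity zero    K = false
  parity (suc B) K = f (window K) xor parity B (drop blockLength K)

  window-++ : ∀ K₀ K₁ K₂ → length K₀ ≡ r → length K₁ ≡ H → length K₂ ≡ r →
              window (K₀ ++ (K₁ ++ K₂)) ≡ K₁
  window-++ K₀ K₁ K₂ e₀ e₁ e₂ = begin
    take H (drop r (take blockLength (K₀ ++ (K₁ ++ K₂))))
      ≡⟨ cong (λ K → take H (drop r K)) (take-all blockLength _ (ℕ.≤-reflexive length≡)) ⟩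
    take H (drop r (K₀ ++ (K₁ ++ K₂))) ≡⟨ cong (take H) (drop-length-++ K₀ _ e₀) ⟩
    take H (K₁ ++ K₂)                  ≡⟨ take-length-++ K₁ K₂ e₁ ⟩
    K₁                                 ∎
    where
    open ≡-Reasoning
    length≡ : length (K₀ ++ (K₁ ++ K₂)) ≡ blockLength
    length≡ = trans (length-++ K₀) (cong₂ _+_ e₀ (trans (length-++ K₁) (cong₂ _+_ e₁ e₂)))

module Gain (y : ℕ → ℕ) (a b : ℕ) (f : List ℕ → Bool) (q H : ℕ) where

  open Words y a b

  -- `j` is where the window of a block starts if no zero precedes it. Of the `s` zeros of the
  -- block, `g` or `g + 1` come before the window, and these two choices give opposite bits.
  ends-change : (s j : ℕ) → Set
  ends-change s j = ∃[ g ] ∃[ h ] s ≡ g + suc h ×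
    f (segment y H (j + g)) ≡ not (f (segment y H (j + suc g)))

  -- A lower bound for the weight of the words of a block with a given split of its `s` zeros around
  -- the window: `b` per one, `a` per zero, and at least `q ^ s` placements of the zeros.
  swapWeight : ℕ → ℕ → ℕ
  swapWeight r s = b ^ (r + (H + r)) * (a ^ s * q ^ s)

  module _ (θ : Bool → ℕ → ℕ → ℤ) (c : ℕ)
           (θ-not : ∀ β j i → θ β j i ℤ.+ θ (not β) j i ≡ 0ℤ)
           (θ-≤ : ∀ β j i → θ β j i ℤ.≤ + (c * (a + b) ^ i)) where

    private
      bound : ℕ → ℤ
      bound i = + (c * (a + b) ^ i)

      slack : Bool → ℕ → ℕ → ℤ
      slack β j i = bound i ℤ.- θ β j i

      0≤slack : ∀ β j i → 0ℤ ℤ.≤ slack β j i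
      0≤slack β j i = ℤ.i≤j⇒0≤j-i (θ-≤ β j i)

      -- Either slack alone may vanish, but `θ` changes sign with its bit, so the two slacks cannot
      -- be small together.
      slack-not : ∀ β γ j i → β ≡ not γ → slack β j i ℤ.+ slack γ j i ≡ + 2 ℤ.* bound i
      slack-not β γ j i refl = begin
        (bound i ℤ.- θ (not γ) j i) ℤ.+ (bound i ℤ.- θ γ j i) ≡⟨ lemma (bound i) (θ (not γ) j i) (θ γ j i) ⟩
        + 2 ℤ.* bound i ℤ.- (θ γ j i ℤ.+ θ (not γ) j i)       ≡⟨ cong (ℤ._-_ (+ 2 ℤ.* bound i)) (θ-not γ j i) ⟩
        + 2 ℤ.* bound i ℤ.- 0ℤ                                ≡⟨ ℤ.+-identityʳ _ ⟩
        + 2 ℤ.* bound i                                       ∎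
        where
        open ≡-Reasoning
        lemma : ∀ b u v → (b ℤ.- u) ℤ.+ (b ℤ.- v) ≡ + 2 ℤ.* b ℤ.- (v ℤ.+ u)
        lemma = ℤSolver.solve-∀

    -- Two families of words are kept: `g` or `g + 1` zeros before a window without zeros, and the
    -- rest of the `s` zeros after it. Both end at the same position `p` with `n` zeros left but
    -- with opposite bits, so `slack-not` applies to their common end state.
    slack-gain : ∀ s j n → ends-change s (j + s * q) → ∀ β →
      + swapWeight (s * q) s ℤ.* (+ 2 ℤ.* + (c * (a + b) ^ n)) ℤ.≤
      wordSum (s * q) (s + n) j (λ _ j i → wordSum H i j (λ K j i →
        wordSum (s * q) i j (λ _ j i → slack (β xor f K) j i)))
    slack-gain .(g + suc h) j n (g , h , refl , change) β = begin
      κ ℤ.* (+ 2 ℤ.* bound n)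
        ≡⟨ cong (κ ℤ.*_) (slack-not γ₁ γ₂ p n γ₁≡) ⟨
      κ ℤ.* (slack γ₁ p n ℤ.+ slack γ₂ p n)
        ≡⟨ ℤ.*-distribˡ-+ κ (slack γ₁ p n) (slack γ₂ p n) ⟩
      κ ℤ.* slack γ₁ p n ℤ.+ κ ℤ.* slack γ₂ p n
        ≤⟨ ℤ.+-mono-≤ first second ⟩
      + mass r g ℤ.* middle (j + (r + g)) (suc (h + n))
        ℤ.+ + mass r (suc g) ℤ.* middle (j + (r + suc g)) (h + n)
        ≤⟨ wordSum-term₂ middle 0≤middle r g (h + n) j ⟩
      wordSum r (g + suc (h + n)) j (λ _ → middle)
        ≡⟨ cong (λ i → wordSum r i j (λ _ → middle)) (sym (ℕ.+-assoc g (suc h) n)) ⟩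
      wordSum r (g + suc h + n) j (λ _ → middle)
        ≤⟨ wordSum-mono r (g + suc h + n) j (λ _ j i → middle-≤ j i) ⟩
      wordSum r (g + suc h + n) j _ ∎
      where
      open ℤ.≤-Reasoning
      r : ℕ
      r = (g + suc h) * q
      κ : ℤ
      κ = + swapWeight r (g + suc h)
      right : Bool → ℕ → ℕ → ℤ
      right γ j i = wordSum r i j (λ _ → slack γ)
      0≤right : ∀ γ j i → 0ℤ ℤ.≤ right γ j i
      0≤right γ j i = wordSum-nonNeg r i j (λ _ → 0≤slack γ)
      middle : ℕ → ℕ → ℤ
      middle j i = + (b ^ H) ℤ.* right (β xor f (segment y H j)) (j + H) i
      0≤middle : ∀ j i → 0ℤ ℤ.≤ middle j i
      0≤middle j i = scale-0≤ (b ^ H) (0≤right _ _ i)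
      middle-≤ : ∀ j i → middle j i ℤ.≤ wordSum H i j (λ K → right (β xor f K))
      middle-≤ j i = wordSum-head H i j (λ K → right (β xor f K)) (λ K → 0≤right _)
      γ₁ γ₂ : Bool
      γ₁ = β xor f (segment y H (j + (r + g)))
      γ₂ = β xor f (segment y H (j + (r + suc g)))
      γ₁≡ : γ₁ ≡ not γ₂
      γ₁≡ = trans (cong (β xor_) (subst₂ (λ u v → f (segment y H u) ≡ not (f (segment y H v)))
                    (ℕ.+-assoc j r g) (ℕ.+-assoc j r (suc g)) change))
                  (sym (Bool.not-distribʳ-xor β _))
      p : ℕ
      p = j + (r + suc g) + H + (r + h)
      p≡ : j + (r + g) + H + (r + suc h) ≡ p
      p≡ = lemma j r g h H
        where
        lemma : ∀ j r g h H → j + (r + g) + H + (r + suc h) ≡ j + (r + suc g) + H + (r + h)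
        lemma = ℕSolver.solve-∀
      product-≤ : ∀ x z → x + z ≡ g + suc h →
                  κ ℤ.≤ + mass r x ℤ.* (+ (b ^ H) ℤ.* + mass r z)
      product-≤ x z e = begin
        + (b ^ (r + (H + r)) * (a ^ (g + suc h) * q ^ (g + suc h)))
          ≤⟨ ℤ.+≤+ (ℕ.*-monoʳ-≤ (b ^ (r + (H + r))) (ℕ.*-monoʳ-≤ (a ^ (g + suc h)) spread)) ⟩
        + (b ^ (r + (H + r)) * (a ^ (g + suc h) * (ways r x * ways r z)))
          ≡⟨ cong +_ (cong₂ (λ u v → u * (v * (ways r x * ways r z)))
               (trans (ℕ.^-distribˡ-+-* b r (H + r)) (cong (b ^ r *_) (ℕ.^-distribˡ-+-* b H r)))
               (trans (cong (a ^_) (sym e)) (ℕ.^-distribˡ-+-* a x z))) ⟩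
        + (b ^ r * (b ^ H * b ^ r) * (a ^ x * a ^ z * (ways r x * ways r z)))
          ≡⟨ cong +_ (lemma (b ^ r) (b ^ H) (a ^ x) (a ^ z) (ways r x) (ways r z)) ⟩
        + (mass r x * (b ^ H * mass r z))
          ≡⟨ trans (ℤ.pos-* (mass r x) _) (cong (+ mass r x ℤ.*_) (ℤ.pos-* (b ^ H) (mass r z))) ⟩
        + mass r x ℤ.* (+ (b ^ H) ℤ.* + mass r z) ∎
        where
        spread : q ^ (g + suc h) ≤ ways r x * ways r z
        spread = subst (λ s → q ^ s ≤ ways (s * q) x * ways (s * q) z) e (^≤ways-spread q x z)
        lemma : ∀ R B x z u v → R * (B * R) * (x * z * (u * v)) ≡ R * (x * u) * (B * (R * (z * v)))
        lemma = ℕSolver.solve-∀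
      regroup : ∀ x z γ i → + mass r x ℤ.* (+ (b ^ H) ℤ.* + mass r z) ℤ.* slack γ i n ≡
                + mass r x ℤ.* (+ (b ^ H) ℤ.* (+ mass r z ℤ.* slack γ i n))
      regroup x z γ i = lemma (+ mass r x) (+ (b ^ H)) (+ mass r z) (slack γ i n)
        where
        lemma : ∀ u v w x → u ℤ.* (v ℤ.* w) ℤ.* x ≡ u ℤ.* (v ℤ.* (w ℤ.* x))
        lemma = ℤSolver.solve-∀
      path : ∀ x z γ i → x + z ≡ g + suc h → κ ℤ.* slack γ (i + H + (r + z)) n ℤ.≤
             + mass r x ℤ.* (+ (b ^ H) ℤ.* right γ (i + H) (z + n))
      path x z γ i e = begin
        κ ℤ.* slack γ k n
          ≤⟨ ℤ.*-monoʳ-≤-nonNeg (slack γ k n) {{ℤ.nonNegative (0≤slack γ k n)}} (product-≤ x z e) ⟩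
        + mass r x ℤ.* (+ (b ^ H) ℤ.* + mass r z) ℤ.* slack γ k n
          ≡⟨ regroup x z γ k ⟩
        + mass r x ℤ.* (+ (b ^ H) ℤ.* (+ mass r z ℤ.* slack γ k n))
          ≤⟨ scale-≤ (mass r x) (scale-≤ (b ^ H) (wordSum-term (slack γ) (0≤slack γ) r z n (i + H))) ⟩
        + mass r x ℤ.* (+ (b ^ H) ℤ.* right γ (i + H) (z + n)) ∎
        where
        k : ℕ
        k = i + H + (r + z)
      first : κ ℤ.* slack γ₁ p n ℤ.≤ + mass r g ℤ.* middle (j + (r + g)) (suc (h + n))
      first = subst (λ k → κ ℤ.* slack γ₁ k n ℤ.≤ + mass r g ℤ.* middle (j + (r + g)) (suc (h + n)))
                p≡ (path g (suc h) γ₁ (j + (r + g)) refl)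
      second : κ ℤ.* slack γ₂ p n ℤ.≤ + mass r (suc g) ℤ.* middle (j + (r + suc g)) (h + n)
      second = path (suc g) h γ₂ (j + (r + suc g)) (sym (ℕ.+-suc g h))

    -- Replacing `θ` by its upper bound gives at most the right-hand side, by `wordSum-^`. The total
    -- slack of this replacement is at least the gain of `slack-gain`.
    block-gain : ∀ s j n → ends-change s (j + s * q) → ∀ β →
      let open Colour f (s * q) H in
      wordSum blockLength (s + n) j (λ K j i → θ (β xor f (window K)) j i)
        ℤ.+ + swapWeight (s * q) s ℤ.* (+ 2 ℤ.* + (c * (a + b) ^ n))
      ℤ.≤ + (c * (a + b) ^ (blockLength + (s + n)))
    block-gain s j n change β = begin
      Θ ℤ.+ + swapWeight r s ℤ.* (+ 2 ℤ.* bound n)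
        ≤⟨ ℤ.+-monoʳ-≤ Θ (slack-gain s j n change β) ⟩
      Θ ℤ.+ wordSum r (s + n) j (λ _ j i → wordSum H i j (λ K j i →
              wordSum r i j (λ _ j i → slack (β xor f K) j i)))
        ≡⟨ cong (ℤ._+_ Θ) split ⟨
      Θ ℤ.+ wordSum blockLength (s + n) j (λ K j i → slack (β xor f (window K)) j i)
        ≡⟨ wordSum-⊕ blockLength (s + n) j _ _ ⟨
      wordSum blockLength (s + n) j (λ K j i → θ (β xor f (window K)) j i ℤ.+ slack (β xor f (window K)) j i)
        ≡⟨ wordSum-cong blockLength (s + n) j (λ K j i _ → cancel (θ (β xor f (window K)) j i) i) ⟩
      wordSum blockLength (s + n) j (λ _ _ i → + c ℤ.* + ((a + b) ^ i))
        ≡⟨ wordSum-*ˡ blockLength (s + n) j (+ c) _ ⟩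
      + c ℤ.* wordSum blockLength (s + n) j (λ _ _ i → + ((a + b) ^ i))
        ≤⟨ scale-≤ c (wordSum-^ blockLength (s + n) j) ⟩
      + c ℤ.* + ((a + b) ^ (blockLength + (s + n)))
        ≡⟨ ℤ.pos-* c _ ⟨
      + (c * (a + b) ^ (blockLength + (s + n))) ∎
      where
      open ℤ.≤-Reasoning
      open Colour f (s * q) H
      r : ℕ
      r = s * q
      Θ : ℤ
      Θ = wordSum blockLength (s + n) j (λ K j i → θ (β xor f (window K)) j i)
      cancel : ∀ x i → x ℤ.+ (bound i ℤ.- x) ≡ + c ℤ.* + ((a + b) ^ i)
      cancel x i = trans (lemma x (bound i)) (ℤ.pos-* c _)
        where
        lemma : ∀ x y → x ℤ.+ (y ℤ.- x) ≡ y
        lemma = ℤSolver.solve-∀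
      split : wordSum blockLength (s + n) j (λ K j i → slack (β xor f (window K)) j i) ≡
              wordSum r (s + n) j (λ _ j i → wordSum H i j (λ K j i →
                wordSum r i j (λ _ j i → slack (β xor f K) j i)))
      split = trans (wordSum-+ r (H + r) (s + n) j _) (wordSum-cong r (s + n) j λ K₀ j₀ i₀ e₀ →
              trans (wordSum-+ H r i₀ j₀ _) (wordSum-cong H i₀ j₀ λ K₁ j₁ i₁ e₁ →
              wordSum-cong r i₁ j₁ λ K₂ j₂ i₂ e₂ →
                cong (λ K → slack (β xor f K) j₂ i₂) (window-++ K₀ K₁ K₂ e₀ e₁ e₂)))

-- The bias of the parity colouring

-- `ω` weights the zeros left at the end of the word. As it vanishes below `s`, every state that
-- counts can still afford the `s` zeros of a swap. `gain` says that a swap saves at least the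
-- fraction `1 / (Q + 1)` of the trivial bound for a block.
module Bias (y : ℕ → ℕ) (a b : ℕ) (f : List ℕ → Bool) (q H : ℕ) (s Q : ℕ) (ω : ℕ → ℕ)
  (ω≡0 : ∀ i → i < s → ω i ≡ 0) (ω≤ : ∀ i → ω i ≤ (a + b) ^ i)
  (change : ∀ j → Gain.ends-change y a b f q H s j)
  (gain : (a + b) ^ (s * q + (H + s * q) + s) ≤ suc Q * (2 * Gain.swapWeight y a b f q H (s * q) s)) where

  open Words y a b
  open Gain y a b f q H
  open Colour f (s * q) H

  biasWeight : ℕ → Bool → List ℕ → ℕ → ℕ → ℤ
  biasWeight B β K j i = sgn (β xor parity B K) ℤ.* + ω i

  bias : ℕ → ℕ → Bool → ℕ → ℕ → ℤ
  bias B k β j i = wordSum (total B k) i j (biasWeight B β)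

  bias-not : ∀ B k β j i → bias B k β j i ℤ.+ bias B k (not β) j i ≡ 0ℤ
  bias-not B k β j i = begin
    bias B k β j i ℤ.+ bias B k (not β) j i
      ≡⟨ wordSum-⊕ (total B k) i j _ _ ⟨
    wordSum (total B k) i j (λ K j i → biasWeight B β K j i ℤ.+ biasWeight B (not β) K j i)
      ≡⟨ wordSum-cong (total B k) i j (λ K j i _ → cancel K i) ⟩
    wordSum (total B k) i j (λ _ _ _ → 0ℤ)
      ≡⟨ wordSum-vanish (suc i) (total B k) i j _ (λ _ _ _ _ → refl) ℕ.≤-refl ⟩
    0ℤ ∎
    where
    open ≡-Reasoning
    cancel : ∀ K i → sgn (β xor parity B K) ℤ.* + ω i ℤ.+ sgn (not β xor parity B K) ℤ.* + ω i ≡ 0ℤ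
    cancel K i = begin
      sgn x ℤ.* + ω i ℤ.+ sgn (not β xor parity B K) ℤ.* + ω i
        ≡⟨ cong (λ x′ → sgn x ℤ.* + ω i ℤ.+ sgn x′ ℤ.* + ω i) (Bool.not-distribˡ-xor β (parity B K)) ⟨
      sgn x ℤ.* + ω i ℤ.+ sgn (not x) ℤ.* + ω i ≡⟨ ℤ.*-distribʳ-+ (+ ω i) (sgn x) (sgn (not x)) ⟨
      (sgn x ℤ.+ sgn (not x)) ℤ.* + ω i         ≡⟨ cong (ℤ._* + ω i) (sgn-not x) ⟩
      0ℤ ℤ.* + ω i                              ≡⟨ ℤ.*-zeroˡ (+ ω i) ⟩
      0ℤ                                        ∎
      where
      x : Bool
      x = β xor parity B K

  bias-suc : ∀ B k β j i → bias (suc B) k β j i ≡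
             wordSum blockLength i j (λ K j i → bias B k (β xor f (window K)) j i)
  bias-suc B k β j i = trans (wordSum-+ blockLength (total B k) i j _)
    (wordSum-cong blockLength i j λ K j i e → wordSum-cong (total B k) i j λ K′ j i _ →
      cong (λ x → sgn x ℤ.* + ω i) (split K K′ e))
    where
    open ≡-Reasoning
    window-prefix : ∀ K K′ → length K ≡ blockLength → window (K ++ K′) ≡ window K
    window-prefix K K′ e = cong (λ K → take H (drop (s * q) K))
      (trans (take-length-++ K K′ e) (sym (take-all blockLength K (ℕ.≤-reflexive e))))
    split : ∀ K K′ → length K ≡ blockLength →
            β xor parity (suc B) (K ++ K′) ≡ (β xor f (window K)) xor parity B K′
    split K K′ e = begin
      β xor (f (window (K ++ K′)) xor parity B (drop blockLength (K ++ K′)))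
        ≡⟨ cong₂ (λ U V → β xor (f U xor parity B V)) (window-prefix K K′ e) (drop-length-++ K K′ e) ⟩
      β xor (f (window K) xor parity B K′) ≡⟨ Bool.xor-assoc β _ _ ⟨
      (β xor f (window K)) xor parity B K′ ∎

  -- Every block multiplies the trivial bound by `Q / (Q + 1)`; denominators are cleared. The
  -- induction needs all `β`, since the bit of a block is passed on to the later blocks as a sign.
  bias-≤ : ∀ B k β j i → + (suc Q ^ B) ℤ.* bias B k β j i ℤ.≤ + (Q ^ B * (a + b) ^ (total B k + i))
  bias-≤ zero k β j i = begin
    1ℤ ℤ.* bias 0 k β j i                       ≡⟨ ℤ.*-identityˡ _ ⟩
    bias 0 k β j i                              ≤⟨ wordSum-mono k i j (λ K j i →
      ℤ.≤-trans (sgn-≤ (β xor false) (ω i)) (ℤ.+≤+ (ω≤ i))) ⟩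
    wordSum k i j (λ _ _ i → + ((a + b) ^ i))   ≤⟨ wordSum-^ k i j ⟩
    + ((a + b) ^ (k + i))                       ≡⟨ cong +_ (ℕ.+-identityʳ _) ⟨
    + (1 * (a + b) ^ (k + i))                   ∎
    where open ℤ.≤-Reasoning
  bias-≤ (suc B) k β j i with ℕ.≤-<-connex s i
  ... | inj₂ i<s = begin
    + (suc Q ^ suc B) ℤ.* bias (suc B) k β j i
      ≡⟨ cong (+ (suc Q ^ suc B) ℤ.*_) (wordSum-vanish s (total (suc B) k) i j (biasWeight (suc B) β)
           (λ K j i i<s → trans (cong (λ x → sgn (β xor parity (suc B) K) ℤ.* + x) (ω≡0 i i<s))
                                (ℤ.*-zeroʳ (sgn (β xor parity (suc B) K)))) i<s) ⟩
    + (suc Q ^ suc B) ℤ.* 0ℤ  ≡⟨ ℤ.*-zeroʳ (+ (suc Q ^ suc B)) ⟩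
    0ℤ                        ≤⟨ ℤ.+≤+ z≤n ⟩
    + (Q ^ suc B * (a + b) ^ (total (suc B) k + i)) ∎
    where open ℤ.≤-Reasoning
  ... | inj₁ s≤i with ℕ.m≤n⇒∃[o]m+o≡n s≤i
  ...   | n , refl = begin
    + (suc Q ^ suc B) ℤ.* bias (suc B) k β j (s + n)
      ≡⟨ cong (+ (suc Q ^ suc B) ℤ.*_) (bias-suc B k β j (s + n)) ⟩
    + (suc Q * suc Q ^ B) ℤ.* Θ′
      ≡⟨ trans (cong (ℤ._* Θ′) (ℤ.pos-* (suc Q) (suc Q ^ B))) (ℤ.*-assoc (+ suc Q) (+ (suc Q ^ B)) Θ′) ⟩
    + suc Q ℤ.* (+ (suc Q ^ B) ℤ.* Θ′)
      ≡⟨ cong (+ suc Q ℤ.*_) (sym (wordSum-*ˡ blockLength (s + n) j (+ (suc Q ^ B)) _)) ⟩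
    + suc Q ℤ.* Θ
      ≡⟨ lemma₁ (+ suc Q) Θ (κ ℤ.* (+ 2 ℤ.* + (c * d ^ n))) ⟩
    + suc Q ℤ.* (Θ ℤ.+ κ ℤ.* (+ 2 ℤ.* + (c * d ^ n))) ℤ.- + suc Q ℤ.* (κ ℤ.* (+ 2 ℤ.* + (c * d ^ n)))
      -- `X` is the bound without cancellation. By `gain`, `suc Q` times the gain of this block is
      -- at least `X`, which leaves `(Q + 1) * X - X = Q * X`.
      ≤⟨ ℤ.+-mono-≤ (scale-≤ (suc Q) (block-gain θ c θ-not θ-≤ s j n (change (j + s * q)) β)) (ℤ.neg-mono-≤ X≤) ⟩
    + suc Q ℤ.* + X ℤ.- + X
      ≡⟨ lemma₂ (+ Q) (+ X) ⟩
    + Q ℤ.* + X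
      ≡⟨ ℤ.pos-* Q X ⟨
    + (Q * (Q ^ B * d ^ total B k * d ^ (blockLength + (s + n))))
      ≡⟨ cong +_ (trans (lemma₃ Q (Q ^ B) (d ^ total B k) (d ^ (blockLength + (s + n))))
           (cong (Q * Q ^ B *_) (trans (sym (ℕ.^-distribˡ-+-* d (total B k) _))
             (cong (d ^_) (lemma₄ (total B k) blockLength (s + n)))))) ⟩
    + (Q ^ suc B * d ^ (total (suc B) k + (s + n))) ∎
    where
    open ℤ.≤-Reasoning
    d c X : ℕ
    d = a + b
    c = Q ^ B * d ^ total B k
    X = c * d ^ (blockLength + (s + n))
    κ : ℤ
    κ = + swapWeight (s * q) s
    θ : Bool → ℕ → ℕ → ℤ
    θ β j i = + (suc Q ^ B) ℤ.* bias B k β j i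
    Θ′ Θ : ℤ
    Θ′ = wordSum blockLength (s + n) j (λ K → bias B k (β xor f (window K)))
    Θ = wordSum blockLength (s + n) j (λ K → θ (β xor f (window K)))
    θ-not : ∀ β j i → θ β j i ℤ.+ θ (not β) j i ≡ 0ℤ
    θ-not β j i = trans (sym (ℤ.*-distribˡ-+ (+ (suc Q ^ B)) _ _))
      (trans (cong (+ (suc Q ^ B) ℤ.*_) (bias-not B k β j i)) (ℤ.*-zeroʳ (+ (suc Q ^ B))))
    θ-≤ : ∀ β j i → θ β j i ℤ.≤ + (c * d ^ i)
    θ-≤ β j i = ℤ.≤-trans (bias-≤ B k β j i) (ℤ.≤-reflexive (cong +_ (trans
      (cong (Q ^ B *_) (ℕ.^-distribˡ-+-* d (total B k) i)) (sym (ℕ.*-assoc (Q ^ B) _ _)))))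
    X≤ : + X ℤ.≤ + suc Q ℤ.* (κ ℤ.* (+ 2 ℤ.* + (c * d ^ n)))
    X≤ = begin
      + (c * d ^ (blockLength + (s + n)))
        ≡⟨ cong (λ e → + (c * e)) (trans (cong (d ^_) (sym (ℕ.+-assoc blockLength s n))) (ℕ.^-distribˡ-+-* d (blockLength + s) n)) ⟩
      + (c * (d ^ (blockLength + s) * d ^ n))
        ≤⟨ ℤ.+≤+ (ℕ.*-monoʳ-≤ c (ℕ.*-monoˡ-≤ (d ^ n) gain)) ⟩
      + (c * (suc Q * (2 * swapWeight (s * q) s) * d ^ n))
        ≡⟨ cong +_ (lemma c (suc Q) (swapWeight (s * q) s) (d ^ n)) ⟩
      + (suc Q * (swapWeight (s * q) s * (2 * (c * d ^ n))))
        ≡⟨ trans (ℤ.pos-* (suc Q) _) (cong (+ suc Q ℤ.*_) (trans (ℤ.pos-* (swapWeight (s * q) s) _) (cong (κ ℤ.*_) (ℤ.pos-* 2 (c * d ^ n))))) ⟩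
      + suc Q ℤ.* (κ ℤ.* (+ 2 ℤ.* + (c * d ^ n))) ∎
      where
      lemma : ∀ c Q w x → c * (Q * (2 * w) * x) ≡ Q * (w * (2 * (c * x)))
      lemma = ℕSolver.solve-∀
    lemma₁ : ∀ Q t x → Q ℤ.* t ≡ Q ℤ.* (t ℤ.+ x) ℤ.- Q ℤ.* x
    lemma₁ = ℤSolver.solve-∀
    lemma₂ : ∀ Q x → (1ℤ ℤ.+ Q) ℤ.* x ℤ.- x ≡ Q ℤ.* x
    lemma₂ = ℤSolver.solve-∀
    lemma₃ : ∀ q Q u v → q * (Q * u * v) ≡ q * Q * (u * v)
    lemma₃ = ℕSolver.solve-∀
    lemma₄ : ∀ t l e → t + (l + e) ≡ l + t + e
    lemma₄ = ℕSolver.solve-∀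

-- Colours of windows

-- Cole–Vishkin recolouring: 2 i + β, where i is the first of the m low binary digits in which
-- u and v differ and β is the digit of u there.
recolour : ℕ → ℕ → ℕ → ℕ
recolour zero    u v = 0
recolour (suc m) u v with u % 2 ℕ.≟ v % 2
... | no  _ = u % 2
... | yes _ = 2 + recolour m (u / 2) (v / 2)

half-<  : ∀ m u → u < 2 ^ suc m → u / 2 < 2 ^ m
half-< m u u< = ℕ.m<n*o⇒m/o<n (subst (u <_) (ℕ.*-comm 2 (2 ^ m)) u<)

halves-≢ : ∀ u v → u ≢ v → u % 2 ≡ v % 2 → u / 2 ≢ v / 2
halves-≢ u v u≢v %≡ /≡ = u≢v (begin
  u                   ≡⟨ ℕ.m≡m%n+[m/n]*n u 2 ⟩
  u % 2 + u / 2 * 2   ≡⟨ cong₂ (λ r d → r + d * 2) %≡ /≡ ⟩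
  v % 2 + v / 2 * 2   ≡⟨ ℕ.m≡m%n+[m/n]*n v 2 ⟨
  v                   ∎)
  where open ≡-Reasoning

recolour-< : ∀ m u v → u ≢ v → u < 2 ^ m → v < 2 ^ m → recolour m u v < 2 * m
recolour-< zero    u v u≢v u< v< = contradiction (trans (ℕ.n<1⇒n≡0 u<) (sym (ℕ.n<1⇒n≡0 v<))) u≢v
recolour-< (suc m) u v u≢v u< v< with u % 2 ℕ.≟ v % 2
... | no  _  = ℕ.<-≤-trans (ℕ.m%n<n u 2) (ℕ.m≤m*n 2 (suc m))
... | yes %≡ = subst (2 + recolour m (u / 2) (v / 2) <_) (sym (ℕ.*-suc 2 m))
  (ℕ.+-monoʳ-< 2 (recolour-< m (u / 2) (v / 2) (halves-≢ u v u≢v %≡) (half-< m u u<) (half-< m v v<)))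

-- Equal new colours would mean that both pairs first differ in the same digit and that `u` and `v`
-- agree in that digit.
recolour-proper : ∀ m u v w → u ≢ v → u < 2 ^ m → v < 2 ^ m → v ≢ w →
                  recolour m u v ≢ recolour m v w
recolour-proper zero    u v w u≢v u< v< v≢w _ = u≢v (trans (ℕ.n<1⇒n≡0 u<) (sym (ℕ.n<1⇒n≡0 v<)))
recolour-proper (suc m) u v w u≢v u< v< v≢w e with u % 2 ℕ.≟ v % 2 | v % 2 ℕ.≟ w % 2
... | no  ≢₁ | no  _  = ≢₁ e
... | no  _  | yes _  = ℕ.<⇒≢ (ℕ.<-≤-trans (ℕ.m%n<n u 2) (ℕ.m≤m+n 2 _)) e
... | yes _  | no  _  = ℕ.<⇒≢ (ℕ.<-≤-trans (ℕ.m%n<n v 2) (ℕ.m≤m+n 2 _)) (sym e)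
... | yes e₁ | yes e₂ = recolour-proper m (u / 2) (v / 2) (w / 2)
  (halves-≢ u v u≢v e₁) (half-< m u u<) (half-< m v v<) (halves-≢ v w v≢w e₂) (ℕ.+-cancelˡ-≡ 2 _ _ e)

-- The colour, at the (l + 1)-st level of the tower counted from the bottom, of the first h + 1 elements.
windowColour : ℕ → ℕ → List ℕ → ℕ
windowColour zero    l []      = 0
windowColour zero    l (x ∷ _) = x
windowColour (suc h) l K       = recolour (2 + tw (suc l) 2)
  (windowColour h (suc l) K) (windowColour h (suc l) (drop 1 K))

ascent : ℕ → List ℕ → Bool
ascent h K = windowColour h 0 K <ᵇ windowColour h 0 (drop 1 K)

2≤tw : ∀ l → 2 ≤ tw (suc l) 2
2≤tw zero    = ℕ.≤-refl
2≤tw (suc l) = ℕ.^-monoʳ-≤ 2 (ℕ.≤-trans (s≤s z≤n) (2≤tw l))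

module _ (y : ℕ → ℕ) (y≢ : ∀ i → y i ≢ y (suc i)) where

  colourAt : ℕ → ℕ → ℕ → ℕ
  colourAt zero    l i = y i
  colourAt (suc h) l i = recolour (2 + tw (suc l) 2) (colourAt h (suc l) i) (colourAt h (suc l) (suc i))

  windowColour-segment : ∀ h l m i → h < m → windowColour h l (segment y m i) ≡ colourAt h l i
  windowColour-segment zero    l (suc m) i _         = refl
  windowColour-segment (suc h) l (suc m) i (s≤s h<m) = cong₂ (recolour (2 + tw (suc l) 2))
    (windowColour-segment h (suc l) (suc m) i (ℕ.m<n⇒m<1+n h<m))
    (windowColour-segment h (suc l) m (suc i) h<m)

  -- With `T = tw (suc l) 2`, the colours one level up are below `4 * 2 ^ T = 2 ^ (2 + T)`, so they
  -- have `2 + T` digits. The new colours are below `2 * (2 + T) ≤ 4 * T`: the factor 4 makes the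
  -- bound reproduce itself down to eight colours at level 0.
  colourAt-proper : ∀ h l → (∀ i → y i < 4 * tw (suc (h + l)) 2) →
    (∀ i → colourAt h l i ≢ colourAt h l (suc i)) × (∀ i → colourAt h l i < 4 * tw (suc l) 2)
  colourAt-proper zero    l y<  = y≢ , y<
  colourAt-proper (suc h) l y<
    with proper , bounded ← colourAt-proper h (suc l)
           (λ i → subst (λ e → y i < 4 * tw (suc e) 2) (sym (ℕ.+-suc h l)) (y< i))
    = (λ i → recolour-proper (2 + T′) _ _ _ (proper i) (bound i) (bound (suc i)) (proper (suc i)))
    , (λ i → ℕ.<-≤-trans (recolour-< (2 + T′) _ _ (proper i) (bound i) (bound (suc i))) final)
    where
    T′ : ℕ
    T′ = tw (suc l) 2
    bound : ∀ i → colourAt h (suc l) i < 2 ^ (2 + T′)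
    bound i = subst (colourAt h (suc l) i <_) (sym (ℕ.^-distribˡ-+-* 2 2 T′)) (bounded i)
    final : 2 * (2 + T′) ≤ 4 * T′
    final = begin
      2 * (2 + T′)    ≤⟨ ℕ.*-monoʳ-≤ 2 (ℕ.+-monoˡ-≤ T′ (2≤tw l)) ⟩
      2 * (T′ + T′)   ≡⟨ lemma T′ ⟩
      4 * T′          ∎
      where
      open ℕ.≤-Reasoning
      lemma : ∀ t → 2 * (t + t) ≡ 4 * t
      lemma = ℕSolver.solve-∀

-- Monotone runs in a bounded sequence of colours

module _ (c : ℕ → ℕ) (c≢ : ∀ i → c i ≢ c (suc i)) where

  up : ℕ → Bool
  up i = c i <ᵇ c (suc i)

  change-or-constant : ∀ s i → (∃[ g ] ∃[ h ] s ≡ g + suc h × up (i + g) ≡ not (up (i + suc g)))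
                             ⊎ (∀ g → g ≤ s → up (i + g) ≡ up i)
  change-or-constant zero    i = inj₂ λ { .0 z≤n → cong up (ℕ.+-identityʳ i) }
  change-or-constant (suc s) i with change-or-constant s i
  ... | inj₁ (g , h , e , change) = inj₁ (g , suc h , trans (cong suc e) (sym (ℕ.+-suc g (suc h))) , change)
  ... | inj₂ constant with up (i + s) Bool.≟ up (i + suc s)
  ...   | no  ≢ = inj₁ (s , 0 , ℕ.+-comm 1 s , Bool.¬-not ≢)
  ...   | yes e = inj₂ λ g g≤ → go g (ℕ.m≤n⇒m<n∨m≡n g≤)
    where
    go : ∀ g → g < suc s ⊎ g ≡ suc s → up (i + g) ≡ up i
    go g        (inj₁ (s≤s g≤s)) = constant g g≤s
    go .(suc s) (inj₂ refl)      = trans (sym e) (constant s ℕ.≤-refl)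

  rising : ∀ s i → (∀ g → g ≤ s → up (i + g) ≡ true) → s < c (i + suc s)
  rising zero i all rewrite ℕ.+-comm i 1 = ℕ.≤-<-trans z≤n
    (ℕ.<ᵇ⇒< (c i) (c (suc i)) (subst T (sym (trans (cong up (sym (ℕ.+-identityʳ i))) (all 0 z≤n))) _))
  rising (suc s) i all = ℕ.≤-<-trans (rising s i (λ g g≤ → all g (ℕ.m≤n⇒m≤1+n g≤)))
    (subst (λ j → c (i + suc s) < c j) (sym (ℕ.+-suc i (suc s)))
      (ℕ.<ᵇ⇒< (c (i + suc s)) (c (suc (i + suc s))) (subst T (sym (all (suc s) ℕ.≤-refl)) _)))

  falling : ∀ s i → (∀ g → g ≤ s → up (i + g) ≡ false) → c (i + suc s) + suc s ≤ c i
  falling zero i all rewrite ℕ.+-comm i 1 | ℕ.+-comm (c (suc i)) 1 =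
    ℕ.≤∧≢⇒< (ℕ.≮⇒≥ λ lt → subst T (trans (cong up (sym (ℕ.+-identityʳ i))) (all 0 z≤n)) (ℕ.<⇒<ᵇ lt)) (c≢ i ∘ sym)
  falling (suc s) i all = begin
    c (i + suc (suc s)) + suc (suc s) ≡⟨ cong (λ j → c j + suc (suc s)) (ℕ.+-suc i (suc s)) ⟩
    c (suc (i + suc s)) + suc (suc s) ≡⟨ ℕ.+-suc _ (suc s) ⟩
    suc (c (suc (i + suc s))) + suc s ≤⟨ ℕ.+-monoˡ-≤ (suc s) step ⟩
    c (i + suc s) + suc s             ≤⟨ falling s i (λ g g≤ → all g (ℕ.m≤n⇒m≤1+n g≤)) ⟩
    c i                               ∎
    where
    open ℕ.≤-Reasoning
    step : c (suc (i + suc s)) < c (i + suc s)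
    step = ℕ.≤∧≢⇒< (ℕ.≮⇒≥ λ lt → subst T (all (suc s) ℕ.≤-refl) (ℕ.<⇒<ᵇ lt)) (c≢ (i + suc s) ∘ sym)

  -- If the direction never changed, `c` would be strictly monotone on `s + 2` consecutive indices
  -- while taking only `s + 1` values.
  change-exists : ∀ s i → (∀ i → c i < suc s) → ∃[ g ] ∃[ h ] s ≡ g + suc h × up (i + g) ≡ not (up (i + suc g))
  change-exists s i c< with change-or-constant s i
  ... | inj₁ change = change
  ... | inj₂ constant with up i
  ...   | true  = contradiction (rising s i constant) (ℕ.≤⇒≯ (ℕ.s≤s⁻¹ (c< (i + suc s))))
  ...   | false = contradiction (ℕ.≤-trans (ℕ.m≤n+m (suc s) _) (falling s i constant)) (ℕ.<⇒≱ (c< i))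

-- The number 7 of zeros per swap comes from the eight colours of the bottom level:
-- `suc 7 = 4 * tw 1 2`.
ascent-change : ∀ (y : ℕ → ℕ) h → (∀ i → y i ≢ y (suc i)) → (∀ i → y i < 4 * tw (suc h) 2) →
                ∀ a b q j → Gain.ends-change y a b (ascent h) q (2 + h) 7 j
ascent-change y h y≢ y< a b q j
  with proper , bounded ← colourAt-proper y y≢ h 0
         (λ i → subst (λ e → y i < 4 * tw (suc e) 2) (sym (ℕ.+-identityʳ h)) (y< i))
  with g , l , e , change ← change-exists (colourAt y y≢ h 0) proper 7 j bounded
  = g , l , e , trans (ascent≡ (j + g)) (trans change (cong not (sym (ascent≡ (j + suc g)))))
  where
  ascent≡ : ∀ i → ascent h (segment y (2 + h) i) ≡ up (colourAt y y≢ h 0) proper i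
  ascent≡ i = cong₂ _<ᵇ_ (windowColour-segment y y≢ h 0 (2 + h) i (ℕ.m≤n⇒m≤1+n ℕ.≤-refl))
                         (windowColour-segment y y≢ h 0 (1 + h) (suc i) ℕ.≤-refl)

-- Subsets as words

length-filter-map : ∀ {A B : Set} {P : A → Set} {Q : B → Set} (P? : Decidable P) (Q? : Decidable Q) (f : A → B) →
  (∀ x → P x → Q (f x)) → (∀ x → Q (f x) → P x) → ∀ xs → length (filter Q? (map f xs)) ≡ length (filter P? xs)
length-filter-map P? Q? f to from []       = refl
length-filter-map P? Q? f to from (x ∷ xs) with P? x | Q? (f x)
... | yes _ | yes _ = cong suc (length-filter-map P? Q? f to from xs)
... | no  _ | no  _ = length-filter-map P? Q? f to from xs
... | yes p | no ¬q = contradiction (to x p) ¬q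
... | no ¬p | yes q = contradiction (from x q) ¬p

length-filter-map-none : ∀ {A B : Set} {Q : B → Set} (Q? : Decidable Q) (f : A → B) →
  (∀ x → ¬ Q (f x)) → ∀ xs → length (filter Q? (map f xs)) ≡ 0
length-filter-map-none Q? f none []       = refl
length-filter-map-none Q? f none (x ∷ xs) with Q? (f x)
... | yes q = contradiction q (none x)
... | no  _ = length-filter-map-none Q? f none xs

elements : ∀ {N} → ℕ → Subset N → List ℕ
elements o Vec.[]              = []
elements o (inside  Vec.∷ S) = o ∷ elements (suc o) S
elements o (outside Vec.∷ S) = elements (suc o) S

length-elements : ∀ {N} o (S : Subset N) → length (elements o S) ≡ ∣ S ∣
length-elements o Vec.[]            = refl
length-elements o (inside  Vec.∷ S) = cong suc (length-elements (suc o) S)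
length-elements o (outside Vec.∷ S) = length-elements (suc o) S

sublistSum : (List ℕ → ℤ) → ℕ → List ℕ → ℤ
sublistSum w zero    ys       = w []
sublistSum w (suc k) []       = 0ℤ
sublistSum w (suc k) (y ∷ ys) = sublistSum (w ∘ (y ∷_)) k ys ℤ.+ sublistSum w (suc k) ys

sublistSum-cong : ∀ {w v} → (∀ K → w K ≡ v K) → ∀ k ys → sublistSum w k ys ≡ sublistSum v k ys
sublistSum-cong eq zero    ys       = eq []
sublistSum-cong eq (suc k) []       = refl
sublistSum-cong eq (suc k) (y ∷ ys) =
  cong₂ ℤ._+_ (sublistSum-cong (λ K → eq (y ∷ K)) k ys) (sublistSum-cong eq (suc k) ys)

sublistSum-⊕ : ∀ w v k ys → sublistSum (λ K → w K ℤ.+ v K) k ys ≡ sublistSum w k ys ℤ.+ sublistSum v k ys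
sublistSum-⊕ w v zero    ys       = refl
sublistSum-⊕ w v (suc k) []       = refl
sublistSum-⊕ w v (suc k) (y ∷ ys)
  rewrite sublistSum-⊕ (w ∘ (y ∷_)) (v ∘ (y ∷_)) k ys | sublistSum-⊕ w v (suc k) ys =
  lemma (sublistSum (w ∘ (y ∷_)) k ys) (sublistSum (v ∘ (y ∷_)) k ys) (sublistSum w (suc k) ys) (sublistSum v (suc k) ys)
  where
  lemma : ∀ a b c d → (a ℤ.+ b) ℤ.+ (c ℤ.+ d) ≡ (a ℤ.+ c) ℤ.+ (b ℤ.+ d)
  lemma = ℤSolver.solve-∀

sublistSum-short : ∀ w k ys → length ys < k → sublistSum w k ys ≡ 0ℤ
sublistSum-short w (suc k) []       _         = refl
sublistSum-short w (suc k) (y ∷ ys) (s≤s lt) =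
  cong₂ ℤ._+_ (sublistSum-short _ k ys lt) (sublistSum-short w (suc k) ys (ℕ.m<n⇒m<1+n lt))

sublistSum-1 : ∀ k ys → sublistSum (λ _ → 1ℤ) k ys ≡ + (length ys C k)
sublistSum-1 zero    ys       = refl
sublistSum-1 (suc k) []       = refl
sublistSum-1 (suc k) (y ∷ ys) = trans (cong₂ ℤ._+_ (sublistSum-1 k ys) (sublistSum-1 (suc k) ys))
  (cong +_ (nCk+nC[k+1]≡[n+1]C[k+1] (length ys) k))

indicator : Bool → Bool → ℤ
indicator β x = if does (x Bool.≟ β) then 1ℤ else 0ℤ

indicator-sgn : ∀ β x → indicator β x ℤ.+ indicator β x ≡ 1ℤ ℤ.+ sgn (β xor x)
indicator-sgn false false = refl
indicator-sgn false true  = refl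
indicator-sgn true  false = refl
indicator-sgn true  true  = refl

colourBy : ∀ {N k} → ℕ → (List ℕ → Bool) → Colouring N k
colourBy o g (S , _) = g (elements o S)

-- Induction on `N` for arbitrary `o` and `g`: if the first element is taken, the rest of the set is
-- judged by `g ∘ (o ∷_)`, with elements numbered from `suc o`.
colourCount-sublistSum : ∀ N k o (g : List ℕ → Bool) (M : Subset N) β →
  + colourCount {N} {k} (colourBy o g) M β ≡ sublistSum (indicator β ∘ g) k (elements o M)
colourCount-sublistSum zero zero o g Vec.[] β
  with (Vec.[] ⊆? Vec.[]) ×-dec (g [] Bool.≟ β) | g [] Bool.≟ β
... | yes _        | yes _ = refl
... | no  _        | no  _ = refl
... | yes (_ , e)  | no ¬e = contradiction e ¬e
... | no ¬p        | yes e = contradiction ((λ {_} x → x) , e) ¬p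
colourCount-sublistSum zero (suc k) o g Vec.[] β = refl
colourCount-sublistSum (suc N) zero o g (x Vec.∷ M) β = trans
  (cong +_ (length-filter-map (λ S → (proj₁ S ⊆? M) ×-dec (g (elements (suc o) (proj₁ S)) Bool.≟ β)) _ _
    (λ _ (S⊆M , e) → (λ {i} → out⊆ S⊆M {i}) , e) (λ _ (S⊆M , e) → (λ {i} → drop-∷-⊆ S⊆M {i}) , e) (kSubsets N zero)))
  (colourCount-sublistSum N zero (suc o) g M β)
colourCount-sublistSum (suc N) (suc k) o g (x Vec.∷ M) β = begin
  + length (filter Q? (map f₁ (kSubsets N k) ++ map f₂ (kSubsets N (suc k))))
    ≡⟨ cong (+_ ∘ length) (filter-++ Q? (map f₁ (kSubsets N k)) _) ⟩
  + length (filter Q? (map f₁ (kSubsets N k)) ++ filter Q? (map f₂ (kSubsets N (suc k))))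
    ≡⟨ cong +_ (length-++ (filter Q? (map f₁ (kSubsets N k)))) ⟩
  + length (filter Q? (map f₁ (kSubsets N k))) ℤ.+ + length (filter Q? (map f₂ (kSubsets N (suc k))))
    ≡⟨ cong₂ ℤ._+_ (refl {x = + length (filter Q? (map f₁ (kSubsets N k)))}) without ⟩
  + length (filter Q? (map f₁ (kSubsets N k))) ℤ.+ sublistSum (indicator β ∘ g) (suc k) (elements (suc o) M)
    ≡⟨ byHead x refl ⟩
  sublistSum (indicator β ∘ g) (suc k) (elements o (x Vec.∷ M)) ∎
  where
  open ≡-Reasoning
  f₁ : KSubset N k → KSubset (suc N) (suc k)
  f₁ (S , e) = inside Vec.∷ S , cong suc e
  f₂ : KSubset N (suc k) → KSubset (suc N) (suc k)
  f₂ (S , e) = outside Vec.∷ S , e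
  Q? : Decidable (λ (S : KSubset (suc N) (suc k)) → proj₁ S ⊆ (x Vec.∷ M) × g (elements o (proj₁ S)) ≡ β)
  Q? S = (proj₁ S ⊆? (x Vec.∷ M)) ×-dec (g (elements o (proj₁ S)) Bool.≟ β)
  without : + length (filter Q? (map f₂ (kSubsets N (suc k)))) ≡
            sublistSum (indicator β ∘ g) (suc k) (elements (suc o) M)
  without = trans
    (cong +_ (length-filter-map (λ S → (proj₁ S ⊆? M) ×-dec (g (elements (suc o) (proj₁ S)) Bool.≟ β)) Q? f₂
      (λ _ (S⊆M , e) → (λ {i} → out⊆ S⊆M {i}) , e) (λ _ (S⊆M , e) → (λ {i} → drop-∷-⊆ S⊆M {i}) , e) (kSubsets N (suc k))))
    (colourCount-sublistSum N (suc k) (suc o) g M β)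
  byHead : ∀ x′ → x ≡ x′ →
    + length (filter Q? (map f₁ (kSubsets N k))) ℤ.+ sublistSum (indicator β ∘ g) (suc k) (elements (suc o) M)
    ≡ sublistSum (indicator β ∘ g) (suc k) (elements o (x′ Vec.∷ M))
  byHead inside refl = cong (ℤ._+ sublistSum (indicator β ∘ g) (suc k) (elements (suc o) M)) (trans
    (cong +_ (length-filter-map (λ S → (proj₁ S ⊆? M) ×-dec (g (o ∷ elements (suc o) (proj₁ S)) Bool.≟ β)) Q? f₁
      (λ _ (S⊆M , e) → (λ {i} → in⊆in S⊆M {i}) , e) (λ _ (S⊆M , e) → (λ {i} → drop-∷-⊆ S⊆M {i}) , e) (kSubsets N k)))
    (colourCount-sublistSum N k (suc o) (g ∘ (o ∷_)) M β))
  byHead outside refl = trans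
    (cong (λ l → + l ℤ.+ sublistSum (indicator β ∘ g) (suc k) (elements (suc o) M))
      (length-filter-map-none Q? f₁ (λ S (S⊆M , _) → head∉ (S⊆M Vec.here)) (kSubsets N k)))
    (ℤ.+-identityˡ _)
    where
    head∉ : ¬ ((outside Vec.∷ M) Vec.[ Fin.zero ]= inside)
    head∉ ()

-- Twice the indicator of a colour is one plus a sign, so the signed sum measures the excess over
-- one half.
twice-colourCount : ∀ N k o (g : List ℕ → Bool) (M : Subset N) β →
  let c = + colourCount {N} {k} (colourBy o g) M β in
  c ℤ.+ c ≡ + (∣ M ∣ C k) ℤ.+ sublistSum (λ K → sgn (β xor g K)) k (elements o M)
twice-colourCount N k o g M β = begin
  c ℤ.+ c ≡⟨ cong (λ c → c ℤ.+ c) (colourCount-sublistSum N k o g M β) ⟩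
  sublistSum (indicator β ∘ g) k ys ℤ.+ sublistSum (indicator β ∘ g) k ys
    ≡⟨ sublistSum-⊕ (indicator β ∘ g) (indicator β ∘ g) k ys ⟨
  sublistSum (λ K → indicator β (g K) ℤ.+ indicator β (g K)) k ys
    ≡⟨ sublistSum-cong (λ K → indicator-sgn β (g K)) k ys ⟩
  sublistSum (λ K → 1ℤ ℤ.+ sgn (β xor g K)) k ys
    ≡⟨ sublistSum-⊕ (λ _ → 1ℤ) (λ K → sgn (β xor g K)) k ys ⟩
  sublistSum (λ _ → 1ℤ) k ys ℤ.+ S
    ≡⟨ cong (ℤ._+ S) (trans (sublistSum-1 k ys) (cong (λ l → + (l C k)) (length-elements o M))) ⟩
  + (∣ M ∣ C k) ℤ.+ S ∎
  where
  open ≡-Reasoning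
  c S : ℤ
  c = + colourCount {N} {k} (colourBy o g) M β
  ys : List ℕ
  ys = elements o M
  S = sublistSum (λ K → sgn (β xor g K)) k ys

-- Continues the list by 0, 1, 0, 1, and so on, so that neighbours stay distinct and values stay
-- small at all indices: a change of direction is required from every starting position, also beyond
-- the elements of `M`. Numbering these from 2 keeps them apart from the padding.
extend : List ℕ → ℕ → ℕ
extend []       zero          = 0
extend []       (suc zero)    = 1
extend []       (suc (suc i)) = extend [] i
extend (x ∷ xs) zero          = x
extend (x ∷ xs) (suc i)       = extend xs i

segment-extend : ∀ ys → segment (extend ys) (length ys) 0 ≡ ys
segment-extend []       = refl
segment-extend (x ∷ ys) = cong (x ∷_) (trans (shift (length ys) 0) (segment-extend ys))
  where
  shift : ∀ m j → segment (extend (x ∷ ys)) m (suc j) ≡ segment (extend ys) m j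
  shift zero    j = refl
  shift (suc m) j = cong (extend ys j ∷_) (shift m (suc j))

extend-[]-≢ : ∀ i → extend [] i ≢ extend [] (suc i)
extend-[]-≢ zero          ()
extend-[]-≢ (suc zero)    ()
extend-[]-≢ (suc (suc i)) = extend-[]-≢ i

extend-[]-< : ∀ i → extend [] i < 2
extend-[]-< zero          = s≤s z≤n
extend-[]-< (suc zero)    = s≤s (s≤s z≤n)
extend-[]-< (suc (suc i)) = extend-[]-< i

extend-elements-≢ : ∀ {N} o (M : Subset N) → 2 ≤ o → ∀ i → extend (elements o M) i ≢ extend (elements o M) (suc i)
extend-elements-≢ o Vec.[]            2≤o i       = extend-[]-≢ i
extend-elements-≢ o (outside Vec.∷ M) 2≤o i       = extend-elements-≢ (suc o) M (ℕ.m≤n⇒m≤1+n 2≤o) i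
extend-elements-≢ o (inside  Vec.∷ M) 2≤o (suc i) = extend-elements-≢ (suc o) M (ℕ.m≤n⇒m≤1+n 2≤o) i
extend-elements-≢ o (inside  Vec.∷ M) 2≤o zero    = head-≢ (suc o) M ℕ.≤-refl
  where
  head-≢ : ∀ {N} p (M : Subset N) → o < p → o ≢ extend (elements p M) 0
  head-≢ p Vec.[]            o<p e = ℕ.<⇒≢ (ℕ.<-≤-trans (s≤s z≤n) 2≤o) (sym e)
  head-≢ p (inside  Vec.∷ M) o<p e = ℕ.<⇒≢ o<p e
  head-≢ p (outside Vec.∷ M) o<p e = head-≢ (suc p) M (ℕ.m<n⇒m<1+n o<p) e

extend-elements-< : ∀ {N} o (M : Subset N) → 2 ≤ o → ∀ i → extend (elements o M) i < o + N
extend-elements-< {N} o Vec.[] 2≤o i = ℕ.<-≤-trans (extend-[]-< i) (ℕ.≤-trans 2≤o (ℕ.m≤m+n o 0))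
extend-elements-< {suc N} o (outside Vec.∷ M) 2≤o i =
  subst (extend (elements (suc o) M) i <_) (sym (ℕ.+-suc o N)) (extend-elements-< (suc o) M (ℕ.m≤n⇒m≤1+n 2≤o) i)
extend-elements-< {suc N} o (inside  Vec.∷ M) 2≤o (suc i) =
  subst (extend (elements (suc o) M) i <_) (sym (ℕ.+-suc o N)) (extend-elements-< (suc o) M (ℕ.m≤n⇒m≤1+n 2≤o) i)
extend-elements-< {suc N} o (inside  Vec.∷ M) 2≤o zero = ℕ.m<m+n o (s≤s z≤n)

-- Shifting the number i of remaining zeros by s lets every block use up s zeros.
shiftedPower : ℕ → ℕ → ℕ → ℕ → ℕ
shiftedPower a d zero    i       = a ^ i
shiftedPower a d (suc s) zero    = 0
shiftedPower a d (suc s) (suc i) = d * shiftedPower a d s i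

shiftedPower-≡0 : ∀ a d s i → i < s → shiftedPower a d s i ≡ 0
shiftedPower-≡0 a d (suc s) zero    _         = refl
shiftedPower-≡0 a d (suc s) (suc i) (s≤s i<s) = trans (cong (d *_) (shiftedPower-≡0 a d s i i<s)) (ℕ.*-zeroʳ d)

shiftedPower-≤ : ∀ a d s i → a ≤ d → shiftedPower a d s i ≤ d ^ i
shiftedPower-≤ a d zero    i       a≤d = ℕ.^-monoˡ-≤ i a≤d
shiftedPower-≤ a d (suc s) zero    a≤d = z≤n
shiftedPower-≤ a d (suc s) (suc i) a≤d = ℕ.*-monoʳ-≤ d (shiftedPower-≤ a d s i a≤d)

shiftedPower-+ : ∀ a d s n → shiftedPower a d s (s + n) ≡ d ^ s * a ^ n
shiftedPower-+ a d zero    n = sym (ℕ.+-identityʳ _)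
shiftedPower-+ a d (suc s) n = trans (cong (d *_) (shiftedPower-+ a d s n)) (sym (ℕ.*-assoc d _ _))

-- Word sums as sums over k-subsets

module _ (y : ℕ → ℕ) (a b : ℕ) where

  open Words y a b

  -- Either no zero is available, or reading one leaves fewer than `s`, where the weight vanishes.
  wordSum-drop-zero : ∀ s m j w → (∀ K j i → i < s → w K j i ≡ 0ℤ) →
    wordSum (suc m) s j w ≡ + b ℤ.* wordSum m s (suc j) (w ∘ (y j ∷_))
  wordSum-drop-zero zero    m j w w≡0 = refl
  wordSum-drop-zero (suc s) m j w w≡0 = trans
    (cong (ℤ._+_ (+ b ℤ.* wordSum m (suc s) (suc j) (w ∘ (y j ∷_))))
      (trans (cong (+ a ℤ.*_) (wordSum-vanish (suc s) (suc m) s (suc j) w w≡0 ℕ.≤-refl)) (ℤ.*-zeroʳ (+ a))))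
    (ℤ.+-identityʳ _)

  length-segment : ∀ m j → length (segment y m j) ≡ m
  length-segment zero    j = refl
  length-segment (suc m) j = cong suc (length-segment m (suc j))

  module _ (d s : ℕ) where

    private
      weight : (List ℕ → ℤ) → Weight
      weight w K _ i = w K ℤ.* + shiftedPower a d s i

      weight-≡0 : ∀ w K j i → i < s → weight w K j i ≡ 0ℤ
      weight-≡0 w K j i i<s = trans (cong (λ e → w K ℤ.* + e) (shiftedPower-≡0 a d s i i<s)) (ℤ.*-zeroʳ (w K))

      coefficient : ℕ → ℕ → ℤ
      coefficient k n = + (d ^ s * (a ^ n * b ^ k))

      coefficient-b : ∀ k n → + b ℤ.* coefficient k n ≡ coefficient (suc k) n
      coefficient-b k n = trans (sym (ℤ.pos-* b _)) (cong +_ (lemma b (d ^ s) (a ^ n) (b ^ k)))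
        where
        lemma : ∀ b d a B → b * (d * (a * B)) ≡ d * (a * (b * B))
        lemma = ℕSolver.solve-∀

      coefficient-a : ∀ k n → + a ℤ.* coefficient k n ≡ coefficient k (suc n)
      coefficient-a k n = trans (sym (ℤ.pos-* a _)) (cong +_ (lemma a (d ^ s) (a ^ n) (b ^ k)))
        where
        lemma : ∀ a d A b → a * (d * (A * b)) ≡ d * (a * A * b)
        lemma = ℕSolver.solve-∀

    -- A k-subset of `k + n` elements is a word followed by its trailing zeros. These are the zeros
    -- left beyond the shift `s`, and `shiftedPower` gives them their factors `a`; thus all subsets
    -- carry the same factor. Words with more than `n` zeros have fewer than `s` left and weigh
    -- nothing.
    wordSum-sublistSum : ∀ k n j w → wordSum k (s + n) j (weight w) ≡
                         coefficient k n ℤ.* sublistSum w k (segment y (k + n) j)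
    wordSum-sublistSum zero n j w = begin
      w [] ℤ.* + shiftedPower a d s (s + n)  ≡⟨ cong (λ e → w [] ℤ.* + e) (shiftedPower-+ a d s n) ⟩
      w [] ℤ.* + (d ^ s * a ^ n)             ≡⟨ cong (λ e → w [] ℤ.* + (d ^ s * e)) (ℕ.*-identityʳ (a ^ n)) ⟨
      w [] ℤ.* coefficient 0 n               ≡⟨ ℤ.*-comm (w []) _ ⟩
      coefficient 0 n ℤ.* w []               ∎
      where open ≡-Reasoning
    wordSum-sublistSum (suc k) zero j w = begin
      wordSum (suc k) (s + 0) j (weight w)
        ≡⟨ cong (λ i → wordSum (suc k) i j (weight w)) (ℕ.+-identityʳ s) ⟩
      wordSum (suc k) s j (weight w)
        ≡⟨ wordSum-drop-zero s k j (weight w) (weight-≡0 w) ⟩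
      + b ℤ.* wordSum k s (suc j) (weight w′)
        ≡⟨ cong (λ i → + b ℤ.* wordSum k i (suc j) (weight w′)) (sym (ℕ.+-identityʳ s)) ⟩
      + b ℤ.* wordSum k (s + 0) (suc j) (weight w′)
        ≡⟨ cong (+ b ℤ.*_) (wordSum-sublistSum k zero (suc j) w′) ⟩
      + b ℤ.* (coefficient k 0 ℤ.* sublistSum w′ k ys)
        ≡⟨ sym (ℤ.*-assoc (+ b) (coefficient k 0) _) ⟩
      + b ℤ.* coefficient k 0 ℤ.* sublistSum w′ k ys
        ≡⟨ cong₂ ℤ._*_ (coefficient-b k 0) (sym (trans (cong (λ e → sublistSum w′ k ys ℤ.+ e)
             (sublistSum-short w (suc k) ys (s≤s (ℕ.≤-reflexive (trans (length-segment (k + 0) (suc j)) (ℕ.+-identityʳ k))))))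
             (ℤ.+-identityʳ _))) ⟩
      coefficient (suc k) 0 ℤ.* (sublistSum w′ k ys ℤ.+ sublistSum w (suc k) ys) ∎
      where
      open ≡-Reasoning
      w′ : List ℕ → ℤ
      w′ = w ∘ (y j ∷_)
      ys : List ℕ
      ys = segment y (k + 0) (suc j)
    wordSum-sublistSum (suc k) (suc n) j w = begin
      wordSum (suc k) (s + suc n) j (weight w)
        ≡⟨ cong (λ i → wordSum (suc k) i j (weight w)) (ℕ.+-suc s n) ⟩
      + b ℤ.* wordSum k (suc (s + n)) (suc j) (weight w′) ℤ.+ + a ℤ.* wordSum (suc k) (s + n) (suc j) (weight w)
        ≡⟨ cong (λ i → + b ℤ.* wordSum k i (suc j) (weight w′) ℤ.+ + a ℤ.* wordSum (suc k) (s + n) (suc j) (weight w)) (sym (ℕ.+-suc s n)) ⟩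
      + b ℤ.* wordSum k (s + suc n) (suc j) (weight w′) ℤ.+ + a ℤ.* wordSum (suc k) (s + n) (suc j) (weight w)
        ≡⟨ cong₂ (λ u v → + b ℤ.* u ℤ.+ + a ℤ.* v) (wordSum-sublistSum k (suc n) (suc j) w′)
             (trans (wordSum-sublistSum (suc k) n (suc j) w)
                    (cong (λ e → coefficient (suc k) n ℤ.* sublistSum w (suc k) (segment y e (suc j))) (sym (ℕ.+-suc k n)))) ⟩
      + b ℤ.* (coefficient k (suc n) ℤ.* sublistSum w′ k ys) ℤ.+ + a ℤ.* (coefficient (suc k) n ℤ.* sublistSum w (suc k) ys)
        ≡⟨ cong₂ ℤ._+_ (trans (sym (ℤ.*-assoc (+ b) (coefficient k (suc n)) _)) (cong (ℤ._* sublistSum w′ k ys) (coefficient-b k (suc n))))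
                       (trans (sym (ℤ.*-assoc (+ a) (coefficient (suc k) n) _)) (cong (ℤ._* sublistSum w (suc k) ys) (coefficient-a (suc k) n))) ⟩
      coefficient (suc k) (suc n) ℤ.* sublistSum w′ k ys ℤ.+ coefficient (suc k) (suc n) ℤ.* sublistSum w (suc k) ys
        ≡⟨ sym (ℤ.*-distribˡ-+ (coefficient (suc k) (suc n)) _ _) ⟩
      coefficient (suc k) (suc n) ℤ.* (sublistSum w′ k ys ℤ.+ sublistSum w (suc k) ys) ∎
      where
      open ≡-Reasoning
      w′ : List ℕ → ℤ
      w′ = w ∘ (y j ∷_)
      ys : List ℕ
      ys = segment y (k + suc n) (suc j)

-- Estimates for binomial coefficients

^ˢ≡^ : ∀ x n → x ^ˢ n ≡ x ^ n
^ˢ≡^ x zero    = refl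
^ˢ≡^ x (suc n) = cong (x *_) (^ˢ≡^ x n)

×ˢ≡* : ∀ n x → n ×ˢ x ≡ n * x
×ˢ≡* zero    x = refl
×ˢ≡* (suc n) x = cong (_+_ x) (×ˢ≡* n x)

sum-≤ : ∀ n (f : Fin n → ℕ) c → (∀ i → f i ≤ c) → sum f ≤ n * c
sum-≤ zero    f c f≤ = z≤n
sum-≤ (suc n) f c f≤ = ℕ.+-mono-≤ (f≤ Fin.zero) (sum-≤ n (f ∘ Fin.suc) c (f≤ ∘ Fin.suc))

C*k!*[n∸k]! : ∀ n k → k ≤ n → (n C k) * (k ! * (n ∸ k) !) ≡ n !
C*k!*[n∸k]! n k k≤n = trans (cong (_* (k ! * (n ∸ k) !)) (nCk≡n!/k![n-k]! k≤n)) (ℕ.m/n*n≡m (k![n∸k]!∣n! k≤n))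
  where instance _ = k ℕ.!* (n ∸ k) !≢0

[l+x]!≤l!*[l+x]^x : ∀ l x → (l + x) ! ≤ l ! * (l + x) ^ x
[l+x]!≤l!*[l+x]^x l zero    rewrite ℕ.+-identityʳ l = ℕ.≤-reflexive (sym (ℕ.*-identityʳ (l !)))
[l+x]!≤l!*[l+x]^x l (suc x) rewrite ℕ.+-suc l x = begin
  suc (l + x) * (l + x) !                 ≤⟨ ℕ.*-monoʳ-≤ (suc (l + x)) ([l+x]!≤l!*[l+x]^x l x) ⟩
  suc (l + x) * (l ! * (l + x) ^ x)       ≤⟨ ℕ.*-monoʳ-≤ (suc (l + x)) (ℕ.*-monoʳ-≤ (l !) (ℕ.^-monoˡ-≤ x (ℕ.n≤1+n (l + x)))) ⟩
  suc (l + x) * (l ! * suc (l + x) ^ x)   ≡⟨ lemma (suc (l + x)) (l !) (suc (l + x) ^ x) ⟩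
  l ! * (suc (l + x) * suc (l + x) ^ x)   ∎
  where
  open ℕ.≤-Reasoning
  lemma : ∀ a b c → a * (b * c) ≡ b * (a * c)
  lemma = ℕSolver.solve-∀

n!*n^x≤[n+x]! : ∀ n x → n ! * n ^ x ≤ (n + x) !
n!*n^x≤[n+x]! n zero    rewrite ℕ.+-identityʳ n = ℕ.≤-reflexive (ℕ.*-identityʳ (n !))
n!*n^x≤[n+x]! n (suc x) rewrite ℕ.+-suc n x = begin
  n ! * (n * n ^ x)          ≡⟨ lemma (n !) n (n ^ x) ⟩
  n * (n ! * n ^ x)          ≤⟨ ℕ.*-mono-≤ (ℕ.m≤n⇒m≤1+n (ℕ.m≤m+n n x)) (n!*n^x≤[n+x]! n x) ⟩
  suc (n + x) * (n + x) !    ∎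
  where
  open ℕ.≤-Reasoning
  lemma : ∀ a b c → a * (b * c) ≡ b * (a * c)
  lemma = ℕSolver.solve-∀

-- The binomial distribution with parameters n + k and n / (n + k) has its mode at n.
mode : ∀ n k j l → j + l ≡ n + k → (n ^ j * k ^ l) * (n ! * k !) ≤ (n ^ n * k ^ k) * (j ! * l !)
mode n k j l e with ℕ.≤-total n j
... | inj₁ n≤j = above n k j l e n≤j
  where
  above : ∀ n k j l → j + l ≡ n + k → n ≤ j → (n ^ j * k ^ l) * (n ! * k !) ≤ (n ^ n * k ^ k) * (j ! * l !)
  above n k j l e n≤j with ℕ.m≤n⇒∃[o]m+o≡n n≤j
  -- Now `j = n + x` and `k = x + l`. After common factors are removed, only comparisons of `x`
  -- factors remain: `n ^ x` against `(n + x) ! / n !`, and `(l + x) ! / l !` against `(l + x) ^ x`.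
  ... | x , refl with refl ← ℕ.+-cancelˡ-≡ n k (x + l) (trans (sym e) (ℕ.+-assoc n x l)) rewrite ℕ.+-comm x l = begin
    (n ^ (n + x) * (l + x) ^ l) * (n ! * (l + x) !)
      ≡⟨ cong (λ p → (p * (l + x) ^ l) * (n ! * (l + x) !)) (ℕ.^-distribˡ-+-* n n x) ⟩
    (n ^ n * n ^ x * (l + x) ^ l) * (n ! * (l + x) !)
      ≡⟨ lemma₁ (n ^ n) (n ^ x) ((l + x) ^ l) (n !) ((l + x) !) ⟩
    (n ^ n * (l + x) ^ l) * ((n ! * n ^ x) * (l + x) !)
      ≤⟨ ℕ.*-monoʳ-≤ (n ^ n * (l + x) ^ l) (ℕ.*-mono-≤ (n!*n^x≤[n+x]! n x) ([l+x]!≤l!*[l+x]^x l x)) ⟩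
    (n ^ n * (l + x) ^ l) * ((n + x) ! * (l ! * (l + x) ^ x))
      ≡⟨ lemma₂ (n ^ n) ((l + x) ^ l) ((n + x) !) (l !) ((l + x) ^ x) ⟩
    (n ^ n * ((l + x) ^ l * (l + x) ^ x)) * ((n + x) ! * l !)
      ≡⟨ cong (λ p → (n ^ n * p) * ((n + x) ! * l !)) (ℕ.^-distribˡ-+-* (l + x) l x) ⟨
    (n ^ n * (l + x) ^ (l + x)) * ((n + x) ! * l !) ∎
    where
    open ℕ.≤-Reasoning
    lemma₁ : ∀ a b c d e → (a * b * c) * (d * e) ≡ (a * c) * ((d * b) * e)
    lemma₁ = ℕSolver.solve-∀
    lemma₂ : ∀ a c d e f → (a * c) * (d * (e * f)) ≡ (a * (c * f)) * (d * e)
    lemma₂ = ℕSolver.solve-∀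
... | inj₂ j≤n with ℕ.m≤n⇒∃[o]m+o≡n j≤n
...   | x , refl with refl ← ℕ.+-cancelˡ-≡ j l (x + k) (trans e (ℕ.+-assoc j x k)) = begin
    ((j + x) ^ j * k ^ (x + k)) * ((j + x) ! * k !)
      ≡⟨ cong (λ p → ((j + x) ^ j * p) * ((j + x) ! * k !)) (trans (cong (k ^_) (ℕ.+-comm x k)) (ℕ.^-distribˡ-+-* k k x)) ⟩
    ((j + x) ^ j * (k ^ k * k ^ x)) * ((j + x) ! * k !)
      ≡⟨ lemma₁ ((j + x) ^ j) (k ^ k) (k ^ x) ((j + x) !) (k !) ⟩
    ((j + x) ^ j * k ^ k) * ((j + x) ! * (k ! * k ^ x))
      ≤⟨ ℕ.*-monoʳ-≤ ((j + x) ^ j * k ^ k) (ℕ.*-mono-≤ ([l+x]!≤l!*[l+x]^x j x) (n!*n^x≤[n+x]! k x)) ⟩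
    ((j + x) ^ j * k ^ k) * ((j ! * (j + x) ^ x) * (k + x) !)
      ≡⟨ lemma₂ ((j + x) ^ j) (k ^ k) (j !) ((j + x) ^ x) ((k + x) !) ⟩
    ((j + x) ^ j * (j + x) ^ x) * k ^ k * (j ! * (k + x) !)
      ≡⟨ cong₂ (λ p q → p * k ^ k * (j ! * q !)) (sym (ℕ.^-distribˡ-+-* (j + x) j x)) (ℕ.+-comm k x) ⟩
    ((j + x) ^ (j + x) * k ^ k) * (j ! * (x + k) !) ∎
    where
    open ℕ.≤-Reasoning
    lemma₁ : ∀ a b c d e → (a * (b * c)) * (d * e) ≡ (a * b) * (d * (e * c))
    lemma₁ = ℕSolver.solve-∀
    lemma₂ : ∀ a b c d e → (a * b) * ((c * d) * e) ≡ (a * d) * b * (c * e)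
    lemma₂ = ℕSolver.solve-∀

binomial-≤ : ∀ n k j → j ≤ n + k → ((n + k) C j) * (n ^ j * k ^ (n + k ∸ j)) ≤ ((n + k) C n) * (n ^ n * k ^ k)
binomial-≤ n k j j≤ = ℕ.*-cancelʳ-≤ _ _ (n ! * k !) {{n ℕ.!* k !≢0}} (begin
  ((m C j) * (n ^ j * k ^ l)) * (n ! * k !)    ≡⟨ ℕ.*-assoc (m C j) _ _ ⟩
  (m C j) * ((n ^ j * k ^ l) * (n ! * k !))    ≤⟨ ℕ.*-monoʳ-≤ (m C j) (mode n k j l (ℕ.m+[n∸m]≡n j≤)) ⟩
  (m C j) * ((n ^ n * k ^ k) * (j ! * l !))    ≡⟨ lemma (m C j) (n ^ n * k ^ k) (j ! * l !) ⟩
  ((m C j) * (j ! * l !)) * (n ^ n * k ^ k)    ≡⟨ cong (_* (n ^ n * k ^ k)) (trans (C*k!*[n∸k]! m j j≤) (sym C-n)) ⟩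
  ((m C n) * (n ! * k !)) * (n ^ n * k ^ k)    ≡⟨ lemma′ (m C n) (n ! * k !) (n ^ n * k ^ k) ⟩
  ((m C n) * (n ^ n * k ^ k)) * (n ! * k !)    ∎)
  where
  open ℕ.≤-Reasoning
  m l : ℕ
  m = n + k
  l = m ∸ j
  C-n : (m C n) * (n ! * k !) ≡ m !
  C-n = trans (cong (λ e → (m C n) * (n ! * e !)) (sym (ℕ.m+n∸m≡n n k))) (C*k!*[n∸k]! m n (ℕ.m≤m+n n k))
  lemma : ∀ a b c → a * (b * c) ≡ (a * c) * b
  lemma = ℕSolver.solve-∀
  lemma′ : ∀ a b c → (a * b) * c ≡ (a * c) * b
  lemma′ = ℕSolver.solve-∀

-- The binomial expansion has `n + k + 1` terms, and by `binomial-≤` none exceeds the term at the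
-- mode.
[n+k]^-≤ : ∀ n k → (n + k) ^ (n + k) ≤ suc (n + k) * (((n + k) C n) * (n ^ n * k ^ k))
[n+k]^-≤ n k = begin
  (n + k) ^ m   ≡⟨ ^ˢ≡^ (n + k) m ⟨
  (n + k) ^ˢ m  ≡⟨ Binomial.theorem m n k ⟩
  sum (Binomial.binomialTerm n k m) ≤⟨ sum-≤ (suc m) _ _ term-≤ ⟩
  suc m * ((m C n) * (n ^ n * k ^ k)) ∎
  where
  open ℕ.≤-Reasoning
  m : ℕ
  m = n + k
  term-≤ : ∀ i → Binomial.binomialTerm n k m i ≤ (m C n) * (n ^ n * k ^ k)
  term-≤ i = begin
    (m C toℕ i) ×ˢ (n ^ˢ toℕ i * k ^ˢ (m ∸ toℕ i)) ≡⟨ ×ˢ≡* (m C toℕ i) _ ⟩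
    (m C toℕ i) * (n ^ˢ toℕ i * k ^ˢ (m ∸ toℕ i))  ≡⟨ cong₂ (λ u v → (m C toℕ i) * (u * v)) (^ˢ≡^ n (toℕ i)) (^ˢ≡^ k (m ∸ toℕ i)) ⟩
    (m C toℕ i) * (n ^ toℕ i * k ^ (m ∸ toℕ i))    ≤⟨ binomial-≤ n k (toℕ i) (ℕ.s≤s⁻¹ (Fin.toℕ<n i)) ⟩
    (m C n) * (n ^ n * k ^ k) ∎

-- Bernoulli's inequality and the weight of a block

-- This is `(1 - n / (k + n)) ^ i ≥ 1 - i * n / (k +
-- n)` with denominators cleared, where `e` stands for `k + n - i * n`.
bernoulli : ∀ k n i e → k + n ≡ i * n + e → e * (k + n) ^ i ≤ (k + n) * k ^ i
bernoulli k n zero    e d≡ = ℕ.*-monoˡ-≤ 1 (ℕ.≤-reflexive (sym d≡))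
bernoulli k n (suc i) e d≡ = begin
  e * (d * d ^ i)        ≡⟨ ℕ.*-assoc e d (d ^ i) ⟨
  e * d * d ^ i          ≤⟨ ℕ.*-monoˡ-≤ (d ^ i) step ⟩
  k * (n + e) * d ^ i    ≡⟨ ℕ.*-assoc k (n + e) (d ^ i) ⟩
  k * ((n + e) * d ^ i)  ≤⟨ ℕ.*-monoʳ-≤ k (bernoulli k n i (n + e) (trans d≡ (lemma₁ n (i * n) e))) ⟩
  k * (d * k ^ i)        ≡⟨ lemma₂ k d (k ^ i) ⟩
  d * (k * k ^ i)        ∎
  where
  open ℕ.≤-Reasoning
  d : ℕ
  d = k + n
  lemma₁ : ∀ n x e → n + x + e ≡ x + (n + e)
  lemma₁ = ℕSolver.solve-∀
  lemma₂ : ∀ k d x → k * (d * x) ≡ d * (k * x)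
  lemma₂ = ℕSolver.solve-∀
  k≡ : k ≡ i * n + e
  k≡ = ℕ.+-cancelˡ-≡ n k (i * n + e) (trans (ℕ.+-comm n k) (trans d≡ (ℕ.+-assoc n (i * n) e)))
  step : e * d ≤ k * (n + e)
  step = begin
    e * (k + n)     ≡⟨ lemma₃ e k n ⟩
    e * n + k * e   ≤⟨ ℕ.+-monoˡ-≤ (k * e) (ℕ.*-monoˡ-≤ n (subst (e ≤_) (sym k≡) (ℕ.m≤n+m e (i * n)))) ⟩
    k * n + k * e   ≡⟨ ℕ.*-distribˡ-+ k n e ⟨
    k * (n + e)     ∎
    where
    lemma₃ : ∀ e k n → e * (k + n) ≡ e * n + k * e
    lemma₃ = ℕSolver.solve-∀

ratio^-≤2 : ∀ k n m .{{_ : NonZero n}} → 2 * (m * n) ≤ k + n → (k + n) ^ m ≤ 2 * k ^ m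
ratio^-≤2 k n m 2mn≤d = ℕ.*-cancelˡ-≤ (k + n) {{ℕ.>-nonZero (ℕ.<-≤-trans (ℕ.>-nonZero⁻¹ n) (ℕ.m≤n+m n k))}} (begin
  d * d ^ m            ≤⟨ ℕ.*-monoˡ-≤ (d ^ m) d≤2e ⟩
  2 * e * d ^ m        ≡⟨ ℕ.*-assoc 2 e (d ^ m) ⟩
  2 * (e * d ^ m)      ≤⟨ ℕ.*-monoʳ-≤ 2 (bernoulli k n m e (sym (ℕ.m+[n∸m]≡n mn≤d))) ⟩
  2 * (d * k ^ m)      ≡⟨ lemma 2 d (k ^ m) ⟩
  d * (2 * k ^ m)      ∎)
  where
  open ℕ.≤-Reasoning
  d e : ℕ
  d = k + n
  e = d ∸ m * n
  lemma : ∀ c d x → c * (d * x) ≡ d * (c * x)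
  lemma = ℕSolver.solve-∀
  mn≤d : m * n ≤ d
  mn≤d = ℕ.≤-trans (ℕ.m≤m+n (m * n) _) 2mn≤d
  mn≤e : m * n ≤ e
  mn≤e = ℕ.m+n≤o⇒m≤o∸n (m * n) (subst (_≤ d) (cong (_+_ (m * n)) (ℕ.+-identityʳ (m * n))) 2mn≤d)
  d≤2e : d ≤ 2 * e
  d≤2e = begin
    d             ≡⟨ ℕ.m+[n∸m]≡n mn≤d ⟨
    m * n + e     ≤⟨ ℕ.+-monoˡ-≤ e mn≤e ⟩
    e + e         ≡⟨ cong (_+_ e) (ℕ.+-identityʳ e) ⟨
    2 * e         ∎

ratio^-mono : ∀ c b d L L′ .{{_ : NonZero b}} → b ≤ d → L ≤ L′ → d ^ L′ ≤ c * b ^ L′ → d ^ L ≤ c * b ^ L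
ratio^-mono c b d L L′ b≤d L≤L′ le with ℕ.m≤n⇒∃[o]m+o≡n L≤L′
... | x , refl = ℕ.*-cancelʳ-≤ _ _ (b ^ x) {{ℕ.m^n≢0 b x}} (begin
  d ^ L * b ^ x        ≤⟨ ℕ.*-monoʳ-≤ (d ^ L) (ℕ.^-monoˡ-≤ x b≤d) ⟩
  d ^ L * d ^ x        ≡⟨ ℕ.^-distribˡ-+-* d L x ⟨
  d ^ (L + x)          ≤⟨ le ⟩
  c * b ^ (L + x)      ≡⟨ cong (c *_) (ℕ.^-distribˡ-+-* b L x) ⟩
  c * (b ^ L * b ^ x)  ≡⟨ ℕ.*-assoc c _ _ ⟨
  c * b ^ L * b ^ x    ∎)
  where open ℕ.≤-Reasoning

^-distribʳ-* : ∀ e a b → (a * b) ^ e ≡ a ^ e * b ^ e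
^-distribʳ-* zero    a b = refl
^-distribʳ-* (suc e) a b = trans (cong (a * b *_) (^-distribʳ-* e a b)) (lemma a b (a ^ e) (b ^ e))
  where
  lemma : ∀ a b x y → a * b * (x * y) ≡ a * x * (b * y)
  lemma = ℕSolver.solve-∀

-- Any `m` ones lose at most a factor 2, so the at most `17 * m` ones of a block lose at most
-- `2 ^ 17`. Each of the seven zeros has probability `n / (k + n)` and `m` placements, a loss of at
-- most 4, hence `4 ^ 7` in total.
gain-condition : ∀ k n m h Q .{{_ : NonZero k}} .{{_ : NonZero n}} .{{_ : NonZero m}} →
  2 * (m * n) ≤ k + n → k + n ≤ 4 * (m * n) → h ≤ 2 * m → 2 ^ 31 ≤ Q →
  (n + k) ^ (7 * m + (suc h + 7 * m) + 7) ≤ Q * (2 * (k ^ (7 * m + (suc h + 7 * m)) * (n ^ 7 * m ^ 7)))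
gain-condition k n m h Q 2mn≤ ≤4mn h≤ Q≥ = begin
  (n + k) ^ (L + 7)                          ≡⟨ cong (_^ (L + 7)) (ℕ.+-comm n k) ⟩
  d ^ (L + 7)                                ≡⟨ ℕ.^-distribˡ-+-* d L 7 ⟩
  d ^ L * d ^ 7                              ≤⟨ ℕ.*-mono-≤ d^L≤ (ℕ.^-monoˡ-≤ 7 ≤4mn) ⟩
  2 ^ 17 * k ^ L * (4 * (m * n)) ^ 7         ≡⟨ cong (2 ^ 17 * k ^ L *_) (trans (^-distribʳ-* 7 4 (m * n)) (cong (4 ^ 7 *_) (^-distribʳ-* 7 m n))) ⟩
  2 ^ 17 * k ^ L * (4 ^ 7 * (m ^ 7 * n ^ 7)) ≡⟨ lemma (2 ^ 17) (4 ^ 7) (k ^ L) (m ^ 7) (n ^ 7) ⟩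
  2 ^ 17 * 4 ^ 7 * (k ^ L * (n ^ 7 * m ^ 7)) ≤⟨ ℕ.*-mono-≤ Q≥ (ℕ.m≤n*m (k ^ L * (n ^ 7 * m ^ 7)) 2) ⟩
  Q * (2 * (k ^ L * (n ^ 7 * m ^ 7)))        ∎
  where
  open ℕ.≤-Reasoning
  L d : ℕ
  L = 7 * m + (suc h + 7 * m)
  d = k + n
  lemma : ∀ a b x y z → a * x * (b * (y * z)) ≡ a * b * (x * (z * y))
  lemma = ℕSolver.solve-∀
  L≤ : L ≤ m * 17
  L≤ = begin
    7 * m + (suc h + 7 * m)       ≤⟨ ℕ.+-monoʳ-≤ (7 * m) (ℕ.+-monoˡ-≤ (7 * m) (ℕ.+-mono-≤ (ℕ.>-nonZero⁻¹ m) h≤)) ⟩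
    7 * m + (m + 2 * m + 7 * m)   ≡⟨ lemma′ m ⟩
    m * 17                        ∎
    where
    lemma′ : ∀ m → 7 * m + (m + 2 * m + 7 * m) ≡ m * 17
    lemma′ = ℕSolver.solve-∀
  d^L≤ : d ^ L ≤ 2 ^ 17 * k ^ L
  d^L≤ = ratio^-mono (2 ^ 17) k d L (m * 17) (ℕ.m≤m+n k n) L≤ (begin
    d ^ (m * 17)              ≡⟨ ℕ.^-*-assoc d m 17 ⟨
    (d ^ m) ^ 17              ≤⟨ ℕ.^-monoˡ-≤ 17 (ratio^-≤2 k n m 2mn≤) ⟩
    (2 * k ^ m) ^ 17          ≡⟨ ^-distribʳ-* 17 2 (k ^ m) ⟩
    2 ^ 17 * (k ^ m) ^ 17     ≡⟨ cong (2 ^ 17 *_) (ℕ.^-*-assoc k m 17) ⟩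
    2 ^ 17 * k ^ (m * 17)     ∎)

-- The colouring

-- The case `e = p` of Bernoulli's inequality `(1 + 1 / p) ^ e ≥ 1 + e / p`, which `go` proves for
-- all `e`.
2*p^p≤[1+p]^p : ∀ p .{{_ : NonZero p}} → 2 * p ^ p ≤ suc p ^ p
2*p^p≤[1+p]^p p = ℕ.*-cancelˡ-≤ p (begin
  p * (2 * p ^ p)     ≡⟨ lemma p (p ^ p) ⟩
  (p + p) * p ^ p     ≤⟨ go p ⟩
  p * suc p ^ p       ∎)
  where
  open ℕ.≤-Reasoning
  lemma : ∀ p x → p * (2 * x) ≡ (p + p) * x
  lemma = ℕSolver.solve-∀
  go : ∀ e → (p + e) * p ^ e ≤ p * suc p ^ e
  go zero    = ℕ.≤-reflexive (cong (_* 1) (ℕ.+-identityʳ p))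
  go (suc e) = begin
    (p + suc e) * (p * p ^ e)          ≤⟨ ℕ.m≤m+n _ (e * p ^ e) ⟩
    (p + suc e) * (p * p ^ e) + e * p ^ e ≡⟨ lemma₁ p e (p ^ e) ⟩
    suc p * ((p + e) * p ^ e)          ≤⟨ ℕ.*-monoʳ-≤ (suc p) (go e) ⟩
    suc p * (p * suc p ^ e)            ≡⟨ lemma₂ (suc p) p (suc p ^ e) ⟩
    p * (suc p * suc p ^ e)            ∎
    where
    lemma₁ : ∀ p e x → (p + suc e) * (p * x) + e * x ≡ suc p * ((p + e) * x)
    lemma₁ = ℕSolver.solve-∀
    lemma₂ : ∀ a b c → a * (b * c) ≡ b * (a * c)
    lemma₂ = ℕSolver.solve-∀

-- Saving a factor `p / (p + 1)` in each of `p * e` blocks amounts to saving `2 ^ e`.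
2^e*p^≤[1+p]^ : ∀ p e .{{_ : NonZero p}} → 2 ^ e * p ^ (p * e) ≤ suc p ^ (p * e)
2^e*p^≤[1+p]^ p e = begin
  2 ^ e * p ^ (p * e)    ≡⟨ cong (2 ^ e *_) (ℕ.^-*-assoc p p e) ⟨
  2 ^ e * (p ^ p) ^ e    ≡⟨ ^-distribʳ-* e 2 (p ^ p) ⟨
  (2 * p ^ p) ^ e        ≤⟨ ℕ.^-monoˡ-≤ e (2*p^p≤[1+p]^p p) ⟩
  (suc p ^ p) ^ e        ≡⟨ ℕ.^-*-assoc (suc p) p e ⟩
  suc p ^ (p * e)        ∎
  where open ℕ.≤-Reasoning

total-≡ : ∀ f r H B k → Colour.total f r H B k ≡ B * Colour.blockLength f r H + k
total-≡ f r H zero    k = refl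
total-≡ f r H (suc B) k = trans (cong (_+_ (Colour.blockLength f r H)) (total-≡ f r H B k))
  (sym (ℕ.+-assoc (Colour.blockLength f r H) _ k))

-- The `p * (4 * x)` blocks save `2 ^ (4 * x)`. This pays for the factor `n + k + 1 ≤ 2 ^ (2 + x)`
-- lost to the binomial coefficient and still leaves the required `2 ^ suc x`.
small-bias : ∀ p k n x s .{{_ : NonZero p}} .{{_ : NonZero k}} .{{_ : NonZero n}} →
  n ≤ k → k < 2 ^ suc x → 2 ≤ x →
  suc p ^ (p * (4 * x)) * ((n + k) ^ 7 * (n ^ n * k ^ k) * s) ≤ p ^ (p * (4 * x)) * (n + k) ^ (k + (7 + n)) →
  -- The multiplier `2 ^ (3 + x)` is twice the bound for `n + k + 1`, which makes the inequality
  -- strict.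
  2 ^ suc x * s < (n + k) C n
small-bias p k n x s n≤k k< 2≤x le = ℕ.*-cancelˡ-< (2 ^ (3 + x)) _ _ (begin-strict
  2 ^ (3 + x) * (2 ^ suc x * s)    ≡⟨ ℕ.*-assoc (2 ^ (3 + x)) (2 ^ suc x) s ⟨
  2 ^ (3 + x) * 2 ^ suc x * s      ≡⟨ cong (_* s) (ℕ.^-distribˡ-+-* 2 (3 + x) (suc x)) ⟨
  2 ^ (3 + x + suc x) * s          ≤⟨ ℕ.*-monoˡ-≤ s (ℕ.^-monoʳ-≤ 2 3+x+1+x≤4x) ⟩
  2 ^ (4 * x) * s                  ≤⟨ scaled ⟩
  suc (n + k) * c                  ≤⟨ ℕ.*-monoˡ-≤ c 1+n+k≤ ⟩
  2 ^ (2 + x) * c                  <⟨ ℕ.*-monoˡ-< c (ℕ.^-monoʳ-< 2 (s≤s (s≤s z≤n)) (ℕ.n<1+n (2 + x))) ⟩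
  2 ^ (3 + x) * c                  ∎)
  where
  open ℕ.≤-Reasoning
  c W D B : ℕ
  c = (n + k) C n
  W = n ^ n * k ^ k
  D = (n + k) ^ 7
  B = p * (4 * x)
  instance
    _ : NonZero (n + k)
    _ = ℕ.>-nonZero (ℕ.<-≤-trans (ℕ.>-nonZero⁻¹ n) (ℕ.m≤m+n n k))
    _ : NonZero W
    _ = ℕ.m*n≢0 (n ^ n) (k ^ k) {{ℕ.m^n≢0 n n}} {{ℕ.m^n≢0 k k}}
    _ : NonZero D
    _ = ℕ.m^n≢0 (n + k) 7
    _ : NonZero (p ^ B)
    _ = ℕ.m^n≢0 p B
    _ : NonZero c
    _ = ℕ.≢-nonZero λ c≡0 → ℕ.≢-nonZero⁻¹ ((n + k) ^ (n + k)) {{ℕ.m^n≢0 (n + k) (n + k)}}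
      (ℕ.n≤0⇒n≡0 (ℕ.≤-trans ([n+k]^-≤ n k) (ℕ.≤-reflexive
        (trans (cong (λ c → suc (n + k) * (c * W)) c≡0) (ℕ.*-zeroʳ (suc (n + k)))))))
  3+x+1+x≤4x : 3 + x + suc x ≤ 4 * x
  3+x+1+x≤4x = begin
    3 + x + suc x       ≡⟨ lemma x ⟩
    2 + 2 + (x + x)     ≤⟨ ℕ.+-monoˡ-≤ (x + x) (ℕ.+-mono-≤ 2≤x 2≤x) ⟩
    x + x + (x + x)     ≡⟨ lemma′ x ⟩
    4 * x               ∎
    where
    lemma : ∀ x → 3 + x + suc x ≡ 2 + 2 + (x + x)
    lemma = ℕSolver.solve-∀
    lemma′ : ∀ x → x + x + (x + x) ≡ 4 * x
    lemma′ = ℕSolver.solve-∀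
  1+n+k≤ : suc (n + k) ≤ 2 ^ (2 + x)
  1+n+k≤ = begin
    suc (n + k)                ≤⟨ s≤s (ℕ.+-monoˡ-≤ k n≤k) ⟩
    suc k + k                  ≤⟨ ℕ.+-mono-≤ k< (ℕ.≤-trans (ℕ.<⇒≤ k<) (ℕ.m≤m+n _ 0)) ⟩
    2 ^ suc x + (2 ^ suc x + 0) ∎
  scaled : 2 ^ (4 * x) * s ≤ suc (n + k) * c
  scaled = ℕ.*-cancelˡ-≤ (p ^ B * (D * W)) {{ℕ.m*n≢0 (p ^ B) (D * W) {{it₁}} {{ℕ.m*n≢0 D W}}}} (begin
    p ^ B * (D * W) * (2 ^ (4 * x) * s)             ≡⟨ lemma₁ (p ^ B) (D * W) (2 ^ (4 * x)) s ⟩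
    2 ^ (4 * x) * p ^ B * (D * W * s)               ≤⟨ ℕ.*-monoˡ-≤ (D * W * s) (2^e*p^≤[1+p]^ p (4 * x)) ⟩
    suc p ^ B * (D * W * s)                         ≤⟨ le ⟩
    p ^ B * (n + k) ^ (k + (7 + n))                 ≡⟨ cong (λ e → p ^ B * (n + k) ^ e) (lemma₂ k n) ⟩
    p ^ B * (n + k) ^ (7 + (n + k))                 ≡⟨ cong (p ^ B *_) (ℕ.^-distribˡ-+-* (n + k) 7 (n + k)) ⟩
    p ^ B * (D * (n + k) ^ (n + k))                 ≤⟨ ℕ.*-monoʳ-≤ (p ^ B) (ℕ.*-monoʳ-≤ D ([n+k]^-≤ n k)) ⟩
    p ^ B * (D * (suc (n + k) * (c * W)))           ≡⟨ lemma₃ (p ^ B) D (suc (n + k)) c W ⟩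
    p ^ B * (D * W) * (suc (n + k) * c)             ∎)
    where
    it₁ : NonZero (p ^ B)
    it₁ = ℕ.m^n≢0 p B
    lemma₁ : ∀ a b c s → a * b * (c * s) ≡ c * a * (b * s)
    lemma₁ = ℕSolver.solve-∀
    lemma₂ : ∀ k n → k + (7 + n) ≡ 7 + (n + k)
    lemma₂ = ℕSolver.solve-∀
    lemma₃ : ∀ a d m c w → a * (d * (m * (c * w))) ≡ a * (d * w) * (m * c)
    lemma₃ = ℕSolver.solve-∀

-- A negative signed sum puts the colour below one half at once; only a non-negative one needs the
-- bound.
count-from-bias : ∀ e D c S → + c ℤ.+ + c ≡ + D ℤ.+ S → 0 < D → (∀ s → S ≡ + s → e * s < D) →
                  e * (c + c) < suc e * D
count-from-bias e D c (+ s) eq 0<D S< = begin-strict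
  e * (c + c)     ≡⟨ cong (e *_) (ℤ.+-injective eq) ⟩
  e * (D + s)     ≡⟨ ℕ.*-distribˡ-+ e D s ⟩
  e * D + e * s   <⟨ ℕ.+-monoʳ-< (e * D) (S< s refl) ⟩
  e * D + D       ≡⟨ ℕ.+-comm (e * D) D ⟩
  suc e * D       ∎
  where open ℕ.≤-Reasoning
count-from-bias e D c -[1+ s ] eq 0<D S< = begin-strict
  e * (c + c)     ≤⟨ ℕ.*-monoʳ-≤ e (ℤ.drop‿+≤+ (ℤ.≤-trans (ℤ.≤-reflexive eq) (ℤ.i-j≤i (+ D) (+ suc s)))) ⟩
  e * D           <⟨ ℕ.m<n+m (e * D) 0<D ⟩
  suc e * D       ∎
  where open ℕ.≤-Reasoning

module Colouring-with-small-bias (p k n x : ℕ) .{{p≢0 : NonZero p}} .{{n≢0 : NonZero n}}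
  (2^31≤1+p : 2 ^ 31 ≤ suc p) (4n≤k : 4 * n ≤ k) (68px≤n : 68 * p * x ≤ n) (k< : k < 2 ^ suc x) (2≤x : 2 ≤ x) where

  -- `m` is half of `t` rounded up, so `m * n` lies between a quarter and a half of `k + n`. The
  -- `h = t - 1` recolourings descend from level `t` of the tower to level 1, and `B` is the number
  -- of blocks.
  t m h B : ℕ
  t = k / n
  m = suc t / 2
  h = t ∸ 1
  B = p * (4 * x)

  4≤t : 4 ≤ t
  4≤t = subst (_≤ t) (ℕ.m*n/n≡m 4 n) (ℕ./-monoˡ-≤ n 4n≤k)

  t≡ : suc h ≡ t
  t≡ = ℕ.m+[n∸m]≡n (ℕ.≤-trans (s≤s z≤n) 4≤t)

  1≤n : 1 ≤ n
  1≤n = ℕ.>-nonZero⁻¹ n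

  n≤k : n ≤ k
  n≤k = ℕ.≤-trans (ℕ.m≤n*m n 4) 4n≤k

  tn≤k : t * n ≤ k
  tn≤k = ℕ.m/n*n≤m k n

  2m≤1+t : m * 2 ≤ suc t
  2m≤1+t = ℕ.m/n*n≤m (suc t) 2

  t≤2m : t ≤ 2 * m
  t≤2m = ℕ.s≤s⁻¹ (begin
    suc t                  ≡⟨ ℕ.m≡m%n+[m/n]*n (suc t) 2 ⟩
    suc t % 2 + m * 2      ≤⟨ ℕ.+-monoˡ-≤ (m * 2) (ℕ.s≤s⁻¹ (ℕ.m%n<n (suc t) 2)) ⟩
    suc (m * 2)            ≡⟨ cong suc (ℕ.*-comm m 2) ⟩
    suc (2 * m)            ∎)
    where open ℕ.≤-Reasoning

  instance
    k≢0 : NonZero k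
    k≢0 = ℕ.>-nonZero (ℕ.≤-trans 1≤n n≤k)
    m≢0 : NonZero m
    m≢0 = ℕ.≢-nonZero λ m≡0 → ℕ.<⇒≱ (ℕ.<-≤-trans (s≤s z≤n) 4≤t) (ℕ.≤-trans t≤2m (ℕ.≤-reflexive (cong (2 *_) m≡0)))

  m≤t : m ≤ t
  m≤t = ℕ.s≤s⁻¹ (begin
    suc m       ≤⟨ ℕ.+-monoˡ-≤ m (ℕ.>-nonZero⁻¹ m) ⟩
    m + m       ≡⟨ trans (ℕ.*-comm m 2) (cong (_+_ m) (ℕ.+-identityʳ m)) ⟨
    m * 2       ≤⟨ 2m≤1+t ⟩
    suc t       ∎)
    where open ℕ.≤-Reasoning

  2mn≤k+n : 2 * (m * n) ≤ k + n
  2mn≤k+n = begin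
    2 * (m * n)  ≡⟨ lemma m n ⟩
    m * 2 * n    ≤⟨ ℕ.*-monoˡ-≤ n 2m≤1+t ⟩
    n + t * n    ≤⟨ ℕ.+-monoʳ-≤ n tn≤k ⟩
    n + k        ≡⟨ ℕ.+-comm n k ⟩
    k + n        ∎
    where
    open ℕ.≤-Reasoning
    lemma : ∀ m n → 2 * (m * n) ≡ m * 2 * n
    lemma = ℕSolver.solve-∀

  k+n≤4mn : k + n ≤ 4 * (m * n)
  k+n≤4mn = begin
    k + n                    ≡⟨ cong (_+ n) (ℕ.m≡m%n+[m/n]*n k n) ⟩
    k % n + t * n + n        ≤⟨ ℕ.+-monoˡ-≤ n (ℕ.+-monoˡ-≤ (t * n) (ℕ.<⇒≤ (ℕ.m%n<n k n))) ⟩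
    n + t * n + n            ≡⟨ lemma t n ⟩
    (2 * 1 + t) * n          ≤⟨ ℕ.*-monoˡ-≤ n (ℕ.+-mono-≤ (ℕ.*-monoʳ-≤ 2 (ℕ.>-nonZero⁻¹ m)) t≤2m) ⟩
    (2 * m + 2 * m) * n      ≡⟨ lemma′ m n ⟩
    4 * (m * n)              ∎
    where
    open ℕ.≤-Reasoning
    lemma : ∀ t n → n + t * n + n ≡ (2 * 1 + t) * n
    lemma = ℕSolver.solve-∀
    lemma′ : ∀ m n → (2 * m + 2 * m) * n ≡ 4 * (m * n)
    lemma′ = ℕSolver.solve-∀

  open Colour (ascent h) (7 * m) (2 + h)

  -- A block takes at most `17 * m` elements: `7 * m` on either side and `t + 1 ≤ 3 * m` in the
  -- window. With `4 * x * p` blocks this produces the constant `68 = 4 * 17`.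
  blocks-fit : B * blockLength ≤ k
  blocks-fit = begin
    B * blockLength                       ≤⟨ ℕ.*-monoʳ-≤ B L≤ ⟩
    p * (4 * x) * (17 * m)                ≡⟨ lemma p x m ⟩
    68 * p * x * m                        ≤⟨ ℕ.*-mono-≤ 68px≤n m≤t ⟩
    n * t                                 ≡⟨ ℕ.*-comm n t ⟩
    t * n                                 ≤⟨ tn≤k ⟩
    k                                     ∎
    where
    open ℕ.≤-Reasoning
    lemma : ∀ p x m → p * (4 * x) * (17 * m) ≡ 68 * p * x * m
    lemma = ℕSolver.solve-∀
    lemma′ : ∀ m → 7 * m + (m + 2 * m + 7 * m) ≡ 17 * m
    lemma′ = ℕSolver.solve-∀
    L≤ : blockLength ≤ 17 * m
    L≤ = begin
      7 * m + (suc (suc h) + 7 * m) ≡⟨ cong (λ e → 7 * m + (suc e + 7 * m)) t≡ ⟩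
      7 * m + (1 + t + 7 * m)       ≤⟨ ℕ.+-monoʳ-≤ (7 * m) (ℕ.+-monoˡ-≤ (7 * m) (ℕ.+-mono-≤ (ℕ.>-nonZero⁻¹ m) t≤2m)) ⟩
      7 * m + (m + 2 * m + 7 * m)   ≡⟨ lemma′ m ⟩
      17 * m                        ∎

  -- The elements after the last block, which do not influence the colour.
  k₁ : ℕ
  k₁ = k ∸ B * blockLength

  total-k₁ : total B k₁ ≡ k
  total-k₁ = trans (total-≡ (ascent h) (7 * m) (2 + h) B k₁) (ℕ.m+[n∸m]≡n blocks-fit)

  colouring : ∀ {N} → Colouring N k
  colouring = colourBy 2 (parity B)

  module _ {N : ℕ} (N< : N < tw t 2) (M : Subset N) (∣M∣≡ : ∣ M ∣ ≡ k + n) where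

    ys : List ℕ
    ys = elements 2 M

    y : ℕ → ℕ
    y = extend ys

    y< : ∀ i → y i < 4 * tw (suc h) 2
    y< i = begin-strict
      y i                ≤⟨ ℕ.<⇒≤ (extend-elements-< 2 M ℕ.≤-refl i) ⟩
      2 + N              <⟨ ℕ.+-mono-≤-< (2≤tw h) (subst (λ t → N < tw t 2) (sym t≡) N<) ⟩
      tw (suc h) 2 + tw (suc h) 2 ≤⟨ ℕ.+-monoʳ-≤ (tw (suc h) 2) (ℕ.m≤m+n _ _) ⟩
      4 * tw (suc h) 2   ∎
      where open ℕ.≤-Reasoning

    open Bias y n k (ascent h) m (2 + h) 7 p (shiftedPower n (n + k) 7)
      (shiftedPower-≡0 n (n + k) 7) (λ i → shiftedPower-≤ n (n + k) 7 i (ℕ.m≤m+n n k))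
      (ascent-change y h (extend-elements-≢ 2 M ℕ.≤-refl) y< n k m)
      (gain-condition k n m (suc h) (suc p) 2mn≤k+n k+n≤4mn (subst (_≤ 2 * m) (sym t≡) t≤2m) 2^31≤1+p)

    signedSum : Bool → ℤ
    signedSum β = sublistSum (λ K → sgn (β xor parity B K)) k ys

    ys≡ : segment y (k + n) 0 ≡ ys
    ys≡ = trans (cong (λ l → segment y l 0) (sym (trans (length-elements 2 M) ∣M∣≡))) (segment-extend ys)

    -- The walk starts with `7 + n` zeros although `M` leaves only `n` elements out of a k-subset:
    -- the extra seven are the shift built into `shiftedPower`.
    bias≡ : ∀ β → bias B k₁ β 0 (7 + n) ≡ + ((n + k) ^ 7 * (n ^ n * k ^ k)) ℤ.* signedSum β
    bias≡ β = trans (cong (λ l → Words.wordSum y n k l (7 + n) 0 (biasWeight B β)) total-k₁)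
      (trans (wordSum-sublistSum y n k (n + k) 7 k n 0 (λ K → sgn (β xor parity B K)))
             (cong (λ l → + ((n + k) ^ 7 * (n ^ n * k ^ k)) ℤ.* sublistSum (λ K → sgn (β xor parity B K)) k l) ys≡))

    signedSum-< : ∀ β s → signedSum β ≡ + s → 2 ^ suc x * s < (n + k) C n
    signedSum-< β s e = small-bias p k n x s n≤k k< 2≤x (ℤ.drop‿+≤+ (begin
      + (suc p ^ B * ((n + k) ^ 7 * (n ^ n * k ^ k) * s))
        ≡⟨ trans (ℤ.pos-* (suc p ^ B) _) (cong (+ (suc p ^ B) ℤ.*_) (ℤ.pos-* ((n + k) ^ 7 * (n ^ n * k ^ k)) s)) ⟩
      + (suc p ^ B) ℤ.* (+ ((n + k) ^ 7 * (n ^ n * k ^ k)) ℤ.* + s)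
        ≡⟨ cong (λ S → + (suc p ^ B) ℤ.* (+ ((n + k) ^ 7 * (n ^ n * k ^ k)) ℤ.* S)) e ⟨
      + (suc p ^ B) ℤ.* (+ ((n + k) ^ 7 * (n ^ n * k ^ k)) ℤ.* signedSum β)
        ≡⟨ cong (+ (suc p ^ B) ℤ.*_) (bias≡ β) ⟨
      + (suc p ^ B) ℤ.* bias B k₁ β 0 (7 + n)
        ≤⟨ bias-≤ B k₁ β 0 (7 + n) ⟩
      + (p ^ B * (n + k) ^ (total B k₁ + (7 + n)))
        ≡⟨ cong (λ l → + (p ^ B * (n + k) ^ (l + (7 + n)))) total-k₁ ⟩
      + (p ^ B * (n + k) ^ (k + (7 + n))) ∎))
      where open ℤ.≤-Reasoning

    C≡ : (n + k) C n ≡ (k + n) C k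
    C≡ = trans (cong (_C n) (ℕ.+-comm n k)) (trans (nCk≡nC[n∸k] (ℕ.m≤n+m n k)) (cong ((k + n) C_) (ℕ.m+n∸n≡m k n)))

    colourCount-< : ∀ β → let c = colourCount (colouring {N}) M β in
                    2 ^ suc x * (c + c) < suc (2 ^ suc x) * ((k + n) C k)
    colourCount-< β = count-from-bias (2 ^ suc x) ((k + n) C k) (colourCount (colouring {N}) M β) (signedSum β)
      (trans (twice-colourCount N k 2 (parity B) M β) (cong (λ l → + (l C k) ℤ.+ signedSum β) ∣M∣≡))
      -- The case `s = 0` of `small-bias` shows that the binomial coefficient is positive.
      (subst (0 <_) C≡ (ℕ.≤-<-trans z≤n (small-bias p k n x 0 n≤k k< 2≤x
        (subst (_≤ p ^ B * (n + k) ^ (k + (7 + n))) (sym (trans (cong (suc p ^ B *_) (ℕ.*-zeroʳ ((n + k) ^ 7 * (n ^ n * k ^ k)))) (ℕ.*-zeroʳ (suc p ^ B)))) z≤n))))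
      (λ s e → subst (2 ^ suc x * s <_) C≡ (signedSum-< β s e))

-- Rational and real bounds

infix 10 _/1
_/1 : ℕ → ℚ
n /1 = mkℚ (+ n) 0 (Coprime.sym (Coprime.1-coprimeTo n))

/1≡ : ∀ n → + n ℚ./ 1 ≡ n /1
/1≡ n = ℚ.↥p/↧p≡p (n /1)

/1-* : ∀ m n → (m * n) /1 ≡ m /1 ℚ.* n /1
/1-* m n = trans (sym (/1≡ (m * n))) (cong (ℚ._/ 1) (ℤ.pos-* m n))

/1-+ : ∀ m n → (m + n) /1 ≡ m /1 ℚ.+ n /1
/1-+ m n = trans (sym (/1≡ (m + n))) (cong (ℚ._/ 1)
  (cong₂ ℤ._+_ (sym (ℤ.*-identityʳ (+ m))) (sym (ℤ.*-identityʳ (+ n)))))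

/1-< : ∀ {m n} → m < n → m /1 ℚ.< n /1
/1-< {m} {n} m<n = *<* (subst₂ ℤ._<_ (sym (ℤ.*-identityʳ (+ m))) (sym (ℤ.*-identityʳ (+ n))) (ℤ.+<+ m<n))

/1-≤ : ∀ {m n} → m ≤ n → m /1 ℚ.≤ n /1
/1-≤ {m} {n} m≤n = *≤* (subst₂ ℤ._≤_ (sym (ℤ.*-identityʳ (+ m))) (sym (ℤ.*-identityʳ (+ n))) (ℤ.+≤+ m≤n))

reciprocal : (a : ℚ) .{{_ : Positive a}} → ℚ
reciprocal a = 1/_ a {{ℚ.pos⇒nonZero a}}

reciprocal-cancel : ∀ a .{{_ : Positive a}} s → reciprocal a ℚ.* (a ℚ.* s) ≡ s
reciprocal-cancel a s = trans (sym (ℚ.*-assoc (reciprocal a) a s))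
  (trans (cong (ℚ._* s) (ℚ.*-inverseˡ a {{ℚ.pos⇒nonZero a}})) (ℚ.*-identityˡ s))

reciprocal-< : ∀ a .{{_ : Positive a}} {q s} → q ℚ.< a ℚ.* s → reciprocal a ℚ.* q ℚ.< s
reciprocal-< a {q} {s} q< = subst (reciprocal a ℚ.* q ℚ.<_) (reciprocal-cancel a s)
  (ℚ.*-monoʳ-<-pos (reciprocal a) {{ℚ.1/pos⇒pos a}} q<)

½^-+ : ∀ e f → ½ Defs.^ (e + f) ≡ ½ Defs.^ e ℚ.* ½ Defs.^ f
½^-+ zero    f = sym (ℚ.*-identityˡ _)
½^-+ (suc e) f = trans (cong (½ ℚ.*_) (½^-+ e f)) (sym (ℚ.*-assoc ½ (½ Defs.^ e) (½ Defs.^ f)))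

½^-* : ∀ e f → (½ Defs.^ e) Defs.^ f ≡ ½ Defs.^ (f * e)
½^-* e zero    = refl
½^-* e (suc f) = trans (cong (½ Defs.^ e ℚ.*_) (½^-* e f)) (sym (½^-+ e (f * e)))

0≤½^ : ∀ e → 0ℚ ℚ.≤ ½ Defs.^ e
0≤½^ zero    = *≤* (ℤ.+≤+ z≤n)
0≤½^ (suc e) = subst (ℚ._≤ ½ Defs.^ suc e) (ℚ.*-zeroʳ ½) (ℚ.*-monoˡ-≤-nonNeg ½ (0≤½^ e))

½^-antitone : ∀ e f → e ≤ f → ½ Defs.^ f ℚ.≤ ½ Defs.^ e
½^-antitone zero    zero    _         = ℚ.≤-refl
½^-antitone zero    (suc f) _         = ℚ.≤-trans
  (ℚ.*-monoʳ-≤-nonNeg (½ Defs.^ f) {{ℚ.nonNegative (0≤½^ f)}} {½} {1ℚ} (*≤* (ℤ.+≤+ (s≤s z≤n))))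
  (ℚ.≤-trans (ℚ.≤-reflexive (ℚ.*-identityˡ _)) (½^-antitone zero f z≤n))
½^-antitone (suc e) (suc f) (s≤s e≤f) = ℚ.*-monoˡ-≤-nonNeg ½ (½^-antitone e f e≤f)

2^*½^ : ∀ e → (2 ^ e) /1 ℚ.* ½ Defs.^ e ≡ 1ℚ
2^*½^ zero    = refl
2^*½^ (suc e) = begin
  (2 * 2 ^ e) /1 ℚ.* (½ ℚ.* h)      ≡⟨ cong (ℚ._* (½ ℚ.* h)) (/1-* 2 (2 ^ e)) ⟩
  2 /1 ℚ.* t ℚ.* (½ ℚ.* h)          ≡⟨ solve 4 (λ a t b h → a :* t :* (b :* h) := a :* b :* (t :* h)) refl (2 /1) t ½ h ⟩
  2 /1 ℚ.* ½ ℚ.* (t ℚ.* h)          ≡⟨ cong (2 /1 ℚ.* ½ ℚ.*_) (2^*½^ e) ⟩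
  1ℚ ∎
  where
  open ≡-Reasoning
  open ℚSolver.+-*-Solver
  t h : ℚ
  t = (2 ^ e) /1
  h = ½ Defs.^ e

half-sum-< : ∀ e c D → 2 ^ e * (c + c) < suc (2 ^ e) * D →
             c /1 ℚ.< D /1 ℚ.* (½ ℚ.* (1ℚ ℚ.+ ½ Defs.^ e))
half-sum-< e c D lt = ℚ.*-cancelˡ-<-nonNeg (2 /1 ℚ.* t) {{ℚ.nonNegative 0≤2t}} (begin-strict
  2 /1 ℚ.* t ℚ.* c /1                              ≡⟨ cong (ℚ._* c /1) (/1-* 2 (2 ^ e)) ⟨
  (2 * 2 ^ e) /1 ℚ.* c /1                          ≡⟨ /1-* (2 * 2 ^ e) c ⟨
  (2 * 2 ^ e * c) /1                               ≡⟨ cong _/1 (lemma (2 ^ e) c) ⟩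
  (2 ^ e * (c + c)) /1                             <⟨ /1-< lt ⟩
  (suc (2 ^ e) * D) /1                             ≡⟨ trans (/1-* (1 + 2 ^ e) D) (cong (ℚ._* D /1) (/1-+ 1 (2 ^ e))) ⟩
  (1ℚ ℚ.+ t) ℚ.* D /1                              ≡⟨ cong (λ u → (u ℚ.+ t) ℚ.* D /1) (2^*½^ e) ⟨
  (t ℚ.* h ℚ.+ t) ℚ.* D /1                         ≡⟨ solve 3 (λ t h D → (t :* h :+ t) :* D := con 1ℚ :* t :* (D :* (con 1ℚ :+ h))) refl t h (D /1) ⟩
  1ℚ ℚ.* t ℚ.* (D /1 ℚ.* (1ℚ ℚ.+ h))               ≡⟨ solve 5 (λ a b t D u → a :* b :* t :* (D :* u) := a :* t :* (D :* (b :* u))) refl (2 /1) ½ t (D /1) (1ℚ ℚ.+ h) ⟩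
  2 /1 ℚ.* t ℚ.* (D /1 ℚ.* (½ ℚ.* (1ℚ ℚ.+ h)))     ∎)
  where
  open ℚ.≤-Reasoning
  open ℚSolver.+-*-Solver
  t h : ℚ
  t = (2 ^ e) /1
  h = ½ Defs.^ e
  0≤2t : 0ℚ ℚ.≤ 2 /1 ℚ.* t
  0≤2t = subst (0ℚ ℚ.≤_) (/1-* 2 (2 ^ e)) (/1-≤ z≤n)
  lemma : ∀ t c → 2 * t * c ≡ t * (c + c)
  lemma = ℕSolver.solve-∀

-- Write `z` as `- a / b`. The witness is `½ ^ suc x`: its `b`-th power is at most `½ ^ a`, because
-- `a ≤ b * suc x`.
lower-2^ : ∀ z x → z ℚ.< 0ℚ → ℚ.- (suc x /1) ℚ.≤ z → ∀ {v} → v ℚ.< ½ Defs.^ suc x → ℝ.Lower (2^ z) v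
lower-2^ (mkℚ (+ a) b-1 _) x (*<* z<0) _ _ = contradiction z<0 (ℤ.≤⇒≯ (subst (0ℤ ℤ.≤_) (sym (ℤ.*-identityʳ (+ a))) (ℤ.+≤+ z≤n)))
lower-2^ (mkℚ -[1+ a ] b-1 _) x z<0 (*≤* le) v< = ½ Defs.^ suc x , v< , inj₂ (begin
  (½ Defs.^ suc x) Defs.^ suc b-1  ≡⟨ ½^-* (suc x) (suc b-1) ⟩
  ½ Defs.^ (suc b-1 * suc x)       ≤⟨ ½^-antitone (suc a) (suc b-1 * suc x) 1+a≤ ⟩
  ½ Defs.^ suc a                   ∎)
  where
  open ℚ.≤-Reasoning
  1+a≤ : suc a ≤ suc b-1 * suc x
  1+a≤ = subst₂ _≤_ (ℕ.*-identityʳ (suc a)) (ℕ.*-comm (suc x) (suc b-1))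
    (ℤ.drop‿+≤+ (subst₂ ℤ._≤_ (sym (ℤ.pos-* (suc a) 1)) (sym (ℤ.pos-* (suc x) (suc b-1)))
      (ℤ.neg-cancel-≤ (subst₂ ℤ._≤_ (sym (ℤ.neg-distribˡ-* (+ suc x) (+ suc b-1))) (sym (ℤ.neg-distribˡ-* (+ suc a) 1ℤ)) le))))

lower-log₂ : ∀ k x {v} → 2 ^ x ≤ k → v ℚ.< x /1 → ℝ.Lower (log₂ k) v
lower-log₂ k x 2^x≤k v< = x /1 , v< , inj₂ (subst (2 ^ x ≤_) (sym (ℕ.*-identityʳ k)) 2^x≤k)

-- A lower cut of an `image` is tested on preimages: `c` is divided by `D` and by `½`, diminished by
-- 1, and the result `w - 1` is below `h`, hence below `δ`.
lower-threshold : ∀ D δ c h → 0 < D → (∀ {v} → v ℚ.< h → ℝ.Lower δ v) →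
  c /1 ℚ.< D /1 ℚ.* (½ ℚ.* (1ℚ ℚ.+ h)) → ℝ.Lower (D ×ʳ (½ *ʳ (1ℚ +ʳ δ))) (c /1)
lower-threshold (suc D) δ c h _ below lt = below (subst (ℚ.- 1ℚ ℚ.+ w ℚ.<_)
  (trans (sym (ℚ.+-assoc (ℚ.- 1ℚ) 1ℚ h)) (ℚ.+-identityˡ h))
  (ℚ.+-monoʳ-< (ℚ.- 1ℚ) w<))
  where
  instance
    D>0 : Positive (+ suc D ℚ./ 1)
    D>0 = ℚ.normalize-pos (suc D) 1
  w : ℚ
  w = reciprocal ½ ℚ.* (reciprocal (+ suc D ℚ./ 1) ℚ.* c /1)
  w< : w ℚ.< 1ℚ ℚ.+ h
  w< = reciprocal-< ½ (reciprocal-< (+ suc D ℚ./ 1) (subst (λ d → c /1 ℚ.< d ℚ.* (½ ℚ.* (1ℚ ℚ.+ h))) (sym (/1≡ (suc D))) lt))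

-- Failure of the arrow relation below the tower, and the constants

no-arrow : ∀ p k n x .{{p≢0 : NonZero p}} .{{n≢0 : NonZero n}} → 2 ^ 31 ≤ suc p → 4 * n ≤ k →
  68 * p * x ≤ n → k < 2 ^ suc x → 2 ≤ x → ∀ z → z ℚ.< 0ℚ → ℚ.- (suc x /1) ℚ.≤ z →
  ∀ N → N < tw (k / n) 2 → ¬ Arrows k (k + n) (2^ z) N
no-arrow p k n x p≥ 4n≤k 68px≤n k< 2≤x z z<0 -x≤z N N< arrows =
  let M , β , ∣M∣≡ , threshold≤ = arrows colouring
      c  = colourCount colouring M β
      c< = colourCount-< N< M ∣M∣≡ β
  -- The count `c` itself lies strictly below the threshold, so the relation `≤ʳ` would put `c`
  -- strictly below `c`.
  in ℚ.<-irrefl (sym (/1≡ c)) (threshold≤ (c /1) (lower-threshold ((k + n) C k) (2^ z) c (½ Defs.^ suc x)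
       (0<C c c<) (lower-2^ z x z<0 -x≤z) (half-sum-< (suc x) c ((k + n) C k) c<)))
  where
  open Colouring-with-small-bias p k n x p≥ 4n≤k 68px≤n k< 2≤x
  0<C : ∀ c → 2 ^ suc x * (c + c) < suc (2 ^ suc x) * ((k + n) C k) → 0 < (k + n) C k
  0<C c c< = ℕ.n≢0⇒n>0 λ C≡0 →
    ℕ.n≮0 (subst (2 ^ suc x * (c + c) <_) (trans (cong (suc (2 ^ suc x) *_) C≡0) (ℕ.*-zeroʳ (suc (2 ^ suc x)))) c<)

-- 2 ^ 31 = 2 ^ 17 * 4 ^ 7, the loss in gain-condition.
abstract
  p : ℕ
  p = suc (2 ^ 31)

  p≢0 : NonZero p
  p≢0 = _

  2^31≤1+p : 2 ^ 31 ≤ suc p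
  2^31≤1+p = ℕ.m≤n+m (2 ^ 31) 2

D : ℕ
D = 68 * p

D≢0 : NonZero D
D≢0 = ℕ.m*n≢0 68 p {{_}} {{p≢0}}

D>0 : Positive (D /1)
D>0 = ℚ.positive (/1-< (ℕ.>-nonZero⁻¹ D {{D≢0}}))

theorem1p1 : ∃[ c ] Σ[ c>0 ∈ Positive c ] ∃[ k₀ ] ∃[ ε ] Positive ε ×
    (∀ (k n : ℕ) .{{_ : NonZero n}} → k₀ ≤ k →
    _*ʳ_ c {{c>0}} (log₂ k) ≤ʳ fromℕ n → 4 * n ≤ k →
    ∀ N → IsRamseyNumber k (k + n) (2^ (ℚ.- (ε ℚ.* (+ n ℚ./ 1)))) N →
    tw (k / n) 2 ≤ N)
-- With `c = D` and `ε = 1 / D`, the single number `x = n / D`, rounded down, gives both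
-- `log₂ k < x + 1` and `2 ^ (- ε n) > 2 ^ (- (x + 1))`. The bound `8 ≤ k` forces `2 ≤ x`.
theorem1p1 = D /1 , D>0 , 8 , reciprocal (D /1) {{D>0}} , ℚ.1/pos⇒pos (D /1) {{D>0}} , bound
  where
  instance
    D/1≢0 : NonZero D
    D/1≢0 = D≢0
    D/1>0 : Positive (D /1)
    D/1>0 = D>0
  ε : ℚ
  ε = reciprocal (D /1)
  bound : ∀ (k n : ℕ) .{{_ : NonZero n}} → 8 ≤ k → (D /1 *ʳ log₂ k) ≤ʳ fromℕ n → 4 * n ≤ k →
          ∀ N → IsRamseyNumber k (k + n) (2^ (ℚ.- (ε ℚ.* (+ n ℚ./ 1)))) N → tw (k / n) 2 ≤ N
  bound k n 8≤k log≤ 4n≤k N ramsey = ℕ.≮⇒≥ λ N< →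
    no-arrow p k n x {{p≢0}} 2^31≤1+p 4n≤k
      (ℕ.≤-trans (ℕ.≤-reflexive (ℕ.*-comm D x)) (ℕ.m/n*n≤m n D)) k< 2≤x
      (ℚ.- (ε ℚ.* (+ n ℚ./ 1))) z<0 -x≤z N N< (IsRamseyNumber.arrows ramsey)
    where
    x : ℕ
    x = n / D
    n<D[1+x] : n < D * suc x
    n<D[1+x] = begin-strict
      n                  ≡⟨ ℕ.m≡m%n+[m/n]*n n D ⟩
      n % D + x * D      <⟨ ℕ.+-monoˡ-< (x * D) (ℕ.m%n<n n D) ⟩
      suc x * D          ≡⟨ ℕ.*-comm (suc x) D ⟩
      D * suc x          ∎
      where open ℕ.≤-Reasoning
    n/1< : n /1 ℚ.< D /1 ℚ.* suc x /1
    n/1< = subst (n /1 ℚ.<_) (/1-* D (suc x)) (/1-< n<D[1+x])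
    -- If `2 ^ suc x ≤ k`, then `n / D < x + 1 ≤ log₂ k` puts `n` in the lower cut of `D log₂ k`,
    -- and the hypothesis would put `n` strictly below itself.
    k< : k < 2 ^ suc x
    k< = ℕ.≰⇒> λ 2^≤k → ℚ.<-irrefl (sym (/1≡ n))
      (log≤ (n /1) (lower-log₂ k (suc x) 2^≤k (reciprocal-< (D /1) n/1<)))
    2≤x : 2 ≤ x
    2≤x = ℕ.≮⇒≥ λ x<2 → ℕ.<⇒≱ k< (ℕ.≤-trans (ℕ.^-monoʳ-≤ 2 x<2) (ℕ.≤-trans (ℕ.m≤m+n 4 4) 8≤k))
    z<0 : ℚ.- (ε ℚ.* (+ n ℚ./ 1)) ℚ.< 0ℚ
    z<0 = ℚ.neg-antimono-< {0ℚ} {ε ℚ.* (+ n ℚ./ 1)} (ℚ.positive⁻¹ (ε ℚ.* (+ n ℚ./ 1))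
      {{ℚ.pos*pos⇒pos ε {{ℚ.1/pos⇒pos (D /1)}} (+ n ℚ./ 1) {{ℚ.normalize-pos n 1}}}})
    -x≤z : ℚ.- (suc x /1) ℚ.≤ ℚ.- (ε ℚ.* (+ n ℚ./ 1))
    -x≤z = ℚ.neg-antimono-≤ {ε ℚ.* (+ n ℚ./ 1)} {suc x /1} (begin
      ε ℚ.* (+ n ℚ./ 1)   ≡⟨ cong (ε ℚ.*_) (/1≡ n) ⟩
      ε ℚ.* n /1          <⟨ reciprocal-< (D /1) n/1< ⟩
      suc x /1            ∎)
      where open ℚ.≤-Reasoning
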